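{- Let $G$ be a finite abelian group, $S\subseteq G$ a symmetric subset with $k=|S|$, and $\alpha_0>0$. The Green's function of the uniform diffusion equation on the Cayley graph $X(G,S)$, that is, the inverse $\mathcal{G}=H_0^{ -1}$ of the operator $H_0=L+\alpha_0I$, is $$\mathcal{G}(f)(x)=\sum_{\chi\in\hat G}\ \sum_{y\in G}\frac{1}{\lambda_\chi+\alpha_0}\,f(y)\,\overline{\chi(y)}\,\chi(x),\qquad \lambda_\chi=k-\sum_{s\in S}\overline{\chi(s)}.$$
   Context: A subset $S$ of a group $G$ is symmetric if $g\in S$ implies $g^{ -1}\in S$. The Cayley graph $X(G,S)$ has vertex set $G$ and edge set $\{(g,h)\in G\times G: gh^{ -1}\in S\}$. For functions on $G$, $(f\ast g)(x)=\sum_{y\in G}f(y)g(y^{ -1}x)$. The Laplacian is $L(f)(x)=k f(x)-(\delta_S\ast f)(x)$, where $k=|S|$ and $\delta_S$ is the characteristic function of $S$. The operators act on $\ell^2(G)$, the space of complex-valued functions on $G$; here $f\in\ell^2(G)$ and $x\in G$. The dual group $\hat G=\mathrm{Hom}(G,\mathbb{T})$ is the group of characters of $G$, where $\mathbb{T}$ is the multiplicative group of complex numbers of modulus one. The graph has no boundary here, and $\alpha_0$ is the constant absorption.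
   Formalization: The formula for the Green's function is proved with an extra factor 1/|G|; without it the displayed formula for characters of modulus one is false whenever |G|>1 (for G=Z/2, S empty, α₀=1, H₀ is the identity but the double sum gives 2f(x)). -}

module Defs where

open import Algebra.Bundles using (CommutativeRing; AbelianGroup)
open import Algebra.Structures using (IsCommutativeRing)
open import Algebra.Morphism.Structures using (module GroupMorphisms)
import Algebra.Definitions.RawMonoid as RawMonoidOps
open import Data.Bool.Base using (true; false; if_then_else_)
open import Data.Fin.Base using (Fin; zero; suc)
open import Data.Integer.Base using (+_)
open import Data.List.Base using (length; filter; tabulate)
open import Data.Nat.Base as ℕ using (ℕ; zero; suc)
import Data.Nat.Properties as ℕₚ
open import Data.Product.Base using (∃; _×_; _,_)
open import Data.Rational.Base
  using (ℚ; 0ℚ; 1ℚ; ½; ∣_∣; Positive; positive; nonNegative; nonPositive; 1/_)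
  renaming ( _+_ to _+ℚ_; _*_ to _*ℚ_; -_ to -ℚ_; _-_ to _-ℚ_; _⊔_ to _⊔ℚ_
           ; _/_ to _/ℚ_; _<_ to _<ℚ_; _≤_ to _≤ℚ_)
import Data.Rational.Properties as ℚₚ
open import Data.Rational.Solver using (module +-*-Solver)
open import Data.Sum.Base using (inj₁; inj₂)
open import Function.Base using (_∘_)
open import Function.Bundles using (Inverse; Func; _⟨$⟩_)
import Function.Relation.Binary.Setoid.Equality as FunctionSetoid
open import Level using (Level; 0ℓ; _⊔_) renaming (suc to lsuc)
open import Relation.Binary.Bundles using (Setoid)
open import Relation.Binary.Structures using (IsEquivalence)
open import Relation.Binary.PropositionalEquality
  using (_≡_; refl; sym; trans; cong; cong₂; subst; subst₂)
import Relation.Binary.PropositionalEquality.Properties as ≡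
open import Relation.Nullary.Negation.Core using (contradiction)
open import Relation.Nullary.Decidable.Core using (does; yes; no)
open import Relation.Unary using (Pred; Decidable)

open +-*-Solver using (solve; _:+_; _:*_; :-_; _:-_; _:=_; con)

half : ∀ {ε} → 0ℚ <ℚ ε → 0ℚ <ℚ ½ *ℚ ε
half {ε} ε>0 = ℚₚ.positive⁻¹ _ {{ℚₚ.pos*pos⇒pos ½ ε {{positive ε>0}}}}

half+half : ∀ ε → ½ *ℚ ε +ℚ ½ *ℚ ε ≡ ε
half+half = solve 1 (λ e → con ½ :* e :+ con ½ :* e := e) refl

sum-small : ∀ {ε} a b → ∣ a ∣ <ℚ ½ *ℚ ε → ∣ b ∣ <ℚ ½ *ℚ ε → ∣ a +ℚ b ∣ <ℚ ε
sum-small {ε} a b p q = begin-strict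
  ∣ a +ℚ b ∣          ≤⟨ ℚₚ.∣p+q∣≤∣p∣+∣q∣ a b ⟩
  ∣ a ∣ +ℚ ∣ b ∣      <⟨ ℚₚ.+-mono-< p q ⟩
  ½ *ℚ ε +ℚ ½ *ℚ ε    ≡⟨ half+half ε ⟩
  ε                   ∎
  where open ℚₚ.≤-Reasoning

close-sym : ∀ {ε} a b → ∣ a -ℚ b ∣ <ℚ ε → ∣ b -ℚ a ∣ <ℚ ε
close-sym {ε} a b = subst (_<ℚ ε) (trans (sym (ℚₚ.∣-p∣≡∣p∣ (a -ℚ b)))
  (cong ∣_∣ (solve 2 (λ a b → :- (a :- b) := b :- a) refl a b)))

close-trans : ∀ {ε} a b c → ∣ a -ℚ b ∣ <ℚ ½ *ℚ ε → ∣ b -ℚ c ∣ <ℚ ½ *ℚ ε → ∣ a -ℚ c ∣ <ℚ ε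
close-trans {ε} a b c p q = subst (λ t → ∣ t ∣ <ℚ ε)
  (solve 3 (λ a b c → (a :- b) :+ (b :- c) := a :- c) refl a b c)
  (sum-small (a -ℚ b) (b -ℚ c) p q)

close-+ : ∀ {ε} a a′ b b′ → ∣ a -ℚ a′ ∣ <ℚ ½ *ℚ ε → ∣ b -ℚ b′ ∣ <ℚ ½ *ℚ ε →
          ∣ (a +ℚ b) -ℚ (a′ +ℚ b′) ∣ <ℚ ε
close-+ {ε} a a′ b b′ p q = subst (λ t → ∣ t ∣ <ℚ ε)
  (solve 4 (λ a a′ b b′ → (a :- a′) :+ (b :- b′) := (a :+ b) :- (a′ :+ b′)) refl a a′ b b′)
  (sum-small (a -ℚ a′) (b -ℚ b′) p q)

close-neg : ∀ {ε} a a′ → ∣ a -ℚ a′ ∣ <ℚ ε → ∣ (-ℚ a) -ℚ (-ℚ a′) ∣ <ℚ ε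
close-neg {ε} a a′ p = subst (λ t → ∣ t ∣ <ℚ ε)
  (solve 2 (λ a a′ → a′ :- a := (:- a) :- (:- a′)) refl a a′)
  (close-sym a a′ p)

recip⁺ : (p : ℚ) → Positive p → ℚ
recip⁺ p p>0 = (1/ p) {{ℚₚ.pos⇒nonZero p {{p>0}}}}

recip⁺-pos : ∀ p p>0 → Positive (recip⁺ p p>0)
recip⁺-pos p p>0 = ℚₚ.1/pos⇒pos p {{p>0}}

recip⁺-inverseˡ : ∀ p p>0 → recip⁺ p p>0 *ℚ p ≡ 1ℚ
recip⁺-inverseˡ p p>0 = ℚₚ.*-inverseˡ p {{ℚₚ.pos⇒nonZero p {{p>0}}}}

scale : ∀ {ε} → 0ℚ <ℚ ε → (B : ℚ) → Positive B → ℚ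
scale {ε} _ B B>0 = (½ *ℚ ε) *ℚ recip⁺ B B>0

scale-pos : ∀ {ε} (ε>0 : 0ℚ <ℚ ε) B B>0 → 0ℚ <ℚ scale ε>0 B B>0
scale-pos {ε} ε>0 B B>0 = ℚₚ.positive⁻¹ _
  {{ℚₚ.pos*pos⇒pos (½ *ℚ ε) {{positive (half ε>0)}} (recip⁺ B B>0) {{recip⁺-pos B B>0}}}}

mul-small : ∀ {ε} (ε>0 : 0ℚ <ℚ ε) B (B>0 : Positive B) a b →
            ∣ a ∣ <ℚ scale ε>0 B B>0 → ∣ b ∣ ≤ℚ B → ∣ a *ℚ b ∣ <ℚ ½ *ℚ ε
mul-small {ε} ε>0 B B>0 a b p q = begin-strict
  ∣ a *ℚ b ∣                          ≡⟨ ℚₚ.∣p*q∣≡∣p∣*∣q∣ a b ⟩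
  ∣ a ∣ *ℚ ∣ b ∣                      ≤⟨ ℚₚ.*-monoˡ-≤-nonNeg ∣ a ∣ {{ℚₚ.∣-∣-nonNeg a}} q ⟩
  ∣ a ∣ *ℚ B                          <⟨ ℚₚ.*-monoˡ-<-pos B {{B>0}} p ⟩
  ((½ *ℚ ε) *ℚ recip⁺ B B>0) *ℚ B     ≡⟨ ℚₚ.*-assoc (½ *ℚ ε) (recip⁺ B B>0) B ⟩
  (½ *ℚ ε) *ℚ (recip⁺ B B>0 *ℚ B)     ≡⟨ cong ((½ *ℚ ε) *ℚ_) (recip⁺-inverseˡ B B>0) ⟩
  (½ *ℚ ε) *ℚ 1ℚ                      ≡⟨ ℚₚ.*-identityʳ _ ⟩
  ½ *ℚ ε                              ∎
  where open ℚₚ.≤-Reasoning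

close-* : ∀ {ε} (ε>0 : 0ℚ <ℚ ε) A (A>0 : Positive A) B (B>0 : Positive B) a a′ b b′ →
          ∣ a′ ∣ ≤ℚ A → ∣ b ∣ ≤ℚ B →
          ∣ a -ℚ a′ ∣ <ℚ scale ε>0 B B>0 → ∣ b -ℚ b′ ∣ <ℚ scale ε>0 A A>0 →
          ∣ (a *ℚ b) -ℚ (a′ *ℚ b′) ∣ <ℚ ε
close-* {ε} ε>0 A A>0 B B>0 a a′ b b′ a′≤A b≤B p q = subst (λ t → ∣ t ∣ <ℚ ε)
  (solve 4 (λ a a′ b b′ → (a :- a′) :* b :+ (b :- b′) :* a′ := (a :* b) :- (a′ :* b′)) refl a a′ b b′)
  (sum-small ((a -ℚ a′) *ℚ b) ((b -ℚ b′) *ℚ a′)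
    (mul-small ε>0 B B>0 (a -ℚ a′) b p b≤B)
    (mul-small ε>0 A A>0 (b -ℚ b′) a′ q a′≤A))

close-recip : ∀ {ε η} (ε>0 : Positive ε) (η>0 : Positive η) a b (a>0 : Positive a) (b>0 : Positive b) →
              ε ≤ℚ a → ε ≤ℚ b → ∣ a -ℚ b ∣ <ℚ η *ℚ (ε *ℚ ε) →
              ∣ recip⁺ a a>0 -ℚ recip⁺ b b>0 ∣ <ℚ η
close-recip {ε} {η} ε>0 η>0 a b a>0 b>0 ε≤a ε≤b p =
  ℚₚ.*-cancelʳ-<-nonNeg (a *ℚ b) {{ℚₚ.pos⇒nonNeg (a *ℚ b) {{ab>0}}}} (begin-strict
    ∣ a⁻ -ℚ b⁻ ∣ *ℚ (a *ℚ b)         ≡⟨ cong (∣ a⁻ -ℚ b⁻ ∣ *ℚ_) (sym ∣ab∣) ⟩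
    ∣ a⁻ -ℚ b⁻ ∣ *ℚ ∣ a *ℚ b ∣       ≡⟨ ℚₚ.∣p*q∣≡∣p∣*∣q∣ (a⁻ -ℚ b⁻) (a *ℚ b) ⟨
    ∣ (a⁻ -ℚ b⁻) *ℚ (a *ℚ b) ∣       ≡⟨ cong ∣_∣ clear ⟩
    ∣ b -ℚ a ∣                       <⟨ close-sym a b p ⟩
    η *ℚ (ε *ℚ ε)                    ≤⟨ ℚₚ.*-monoˡ-≤-nonNeg η {{ℚₚ.pos⇒nonNeg η {{η>0}}}} εε≤ab ⟩
    η *ℚ (a *ℚ b)                    ∎)
  where
  open ℚₚ.≤-Reasoning
  a⁻ = recip⁺ a a>0
  b⁻ = recip⁺ b b>0
  ab>0 : Positive (a *ℚ b)
  ab>0 = ℚₚ.pos*pos⇒pos a {{a>0}} b {{b>0}}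
  ∣ab∣ : ∣ a *ℚ b ∣ ≡ a *ℚ b
  ∣ab∣ = ℚₚ.0≤p⇒∣p∣≡p (ℚₚ.<⇒≤ (ℚₚ.positive⁻¹ (a *ℚ b) {{ab>0}}))
  εε≤ab : ε *ℚ ε ≤ℚ a *ℚ b
  εε≤ab = ℚₚ.≤-trans (ℚₚ.*-monoˡ-≤-nonNeg ε {{ℚₚ.pos⇒nonNeg ε {{ε>0}}}} ε≤b)
                     (ℚₚ.*-monoʳ-≤-nonNeg b {{ℚₚ.pos⇒nonNeg b {{b>0}}}} ε≤a)
  clear : (a⁻ -ℚ b⁻) *ℚ (a *ℚ b) ≡ b -ℚ a
  clear = begin-equality
    (a⁻ -ℚ b⁻) *ℚ (a *ℚ b)                 ≡⟨ solve 4 (λ x y a b → (x :- y) :* (a :* b) := (x :* a) :* b :- (y :* b) :* a) refl a⁻ b⁻ a b ⟩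
    (a⁻ *ℚ a) *ℚ b -ℚ (b⁻ *ℚ b) *ℚ a       ≡⟨ cong₂ (λ s t → s *ℚ b -ℚ t *ℚ a) (recip⁺-inverseˡ a a>0) (recip⁺-inverseˡ b b>0) ⟩
    1ℚ *ℚ b -ℚ 1ℚ *ℚ a                     ≡⟨ cong₂ _-ℚ_ (ℚₚ.*-identityˡ b) (ℚₚ.*-identityˡ a) ⟩
    b -ℚ a                                 ∎

Eventually : (ℕ → Set) → Set
Eventually P = ∃ λ N → ∀ n → N ℕ.≤ n → P n

_∩ᵉ_ : ∀ {P Q} → Eventually P → Eventually Q → Eventually (λ n → P n × Q n)
(M , p) ∩ᵉ (N , q) = M ℕ.⊔ N , λ n le →
  p n (ℕₚ.m⊔n≤o⇒m≤o M N le) , q n (ℕₚ.m⊔n≤o⇒n≤o M N le)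

mapᵉ : ∀ {P Q : ℕ → Set} → (∀ n → P n → Q n) → Eventually P → Eventually Q
mapᵉ f (N , p) = N , λ n le → f n (p n le)

Eventually₂ : (ℕ → ℕ → Set) → Set
Eventually₂ P = ∃ λ N → ∀ m n → N ℕ.≤ m → N ℕ.≤ n → P m n

_∩₂_ : ∀ {P Q} → Eventually₂ P → Eventually₂ Q → Eventually₂ (λ m n → P m n × Q m n)
(M , p) ∩₂ (N , q) = M ℕ.⊔ N , λ m n l₁ l₂ →
  p m n (ℕₚ.m⊔n≤o⇒m≤o M N l₁) (ℕₚ.m⊔n≤o⇒m≤o M N l₂) ,
  q m n (ℕₚ.m⊔n≤o⇒n≤o M N l₁) (ℕₚ.m⊔n≤o⇒n≤o M N l₂)

map₂ : ∀ {P Q : ℕ → ℕ → Set} → (∀ m n → P m n → Q m n) → Eventually₂ P → Eventually₂ Q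
map₂ f (N , p) = N , λ m n l₁ l₂ → f m n (p m n l₁ l₂)

both : ∀ {P} → Eventually P → Eventually₂ (λ m n → P m × P n)
both (N , p) = N , λ m n l₁ l₂ → p m l₁ , p n l₂

-- A Cauchy real is a sequence of rationals with the usual ε-N condition;
-- N is part of the data, so no choice is needed to extract moduli.
IsCauchy : (ℕ → ℚ) → Set
IsCauchy x = ∀ ε → 0ℚ <ℚ ε → Eventually₂ (λ m n → ∣ x m -ℚ x n ∣ <ℚ ε)

-- Without η, and with operations given by copatterns, terms such as
-- x +ᴿ y do not unfold during unification.
record ℝ : Set where
  no-eta-equality
  field
    seq    : ℕ → ℚ
    cauchy : IsCauchy seq

open ℝ public

infix 4 _≃_ _<_

-- The types _≃_ and _<_ are records so that the two reals can be
-- recovered by unification.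
record _≃_ (x y : ℝ) : Set where
  constructor mk≃
  field close : ∀ ε → 0ℚ <ℚ ε → Eventually (λ n → ∣ seq x n -ℚ seq y n ∣ <ℚ ε)

open _≃_ public

record _<_ (x y : ℝ) : Set where
  constructor mk<
  field
    gap     : ℚ
    gap-pos : 0ℚ <ℚ gap
    below   : Eventually (λ n → seq x n +ℚ gap ≤ℚ seq y n)

open _<_ public

bounded : (x : ℝ) → ∃ λ B → Positive B × Eventually (λ n → ∣ seq x n ∣ ≤ℚ B)
bounded x with cauchy x 1ℚ (ℚₚ.positive⁻¹ 1ℚ)
... | N , p = B , B>0 , N , λ n le → ℚₚ.<⇒≤ (begin-strict
    ∣ seq x n ∣                            ≡⟨ cong ∣_∣ (solve 2 (λ a b → a := (a :- b) :+ b) refl (seq x n) (seq x N)) ⟩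
    ∣ (seq x n -ℚ seq x N) +ℚ seq x N ∣    ≤⟨ ℚₚ.∣p+q∣≤∣p∣+∣q∣ (seq x n -ℚ seq x N) (seq x N) ⟩
    ∣ seq x n -ℚ seq x N ∣ +ℚ ∣ seq x N ∣  <⟨ ℚₚ.+-monoˡ-< ∣ seq x N ∣ (p n N le ℕₚ.≤-refl) ⟩
    B                                      ∎)
  where
  open ℚₚ.≤-Reasoning
  B = 1ℚ +ℚ ∣ seq x N ∣
  B>0 = ℚₚ.pos+nonNeg⇒pos 1ℚ ∣ seq x N ∣ {{ℚₚ.∣-∣-nonNeg (seq x N)}}

pointwise : ∀ {x y} → (∀ n → seq x n ≡ seq y n) → x ≃ y
pointwise {x} {y} eq .close ε ε>0 = 0 , λ n _ → subst (_<ℚ ε)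
  (sym (cong ∣_∣ (trans (cong (_-ℚ seq y n) (eq n)) (ℚₚ.+-inverseʳ (seq y n))))) ε>0

≃-refl : ∀ {x} → x ≃ x
≃-refl = pointwise λ _ → refl

≃-sym : ∀ {x y} → x ≃ y → y ≃ x
≃-sym {x} {y} p .close ε ε>0 = mapᵉ (λ n → close-sym (seq x n) (seq y n)) (close p ε ε>0)

≃-trans : ∀ {x y z} → x ≃ y → y ≃ z → x ≃ z
≃-trans {x} {y} {z} p q .close ε ε>0 =
  mapᵉ (λ n (a , b) → close-trans (seq x n) (seq y n) (seq z n) a b)
       (close p _ (half ε>0) ∩ᵉ close q _ (half ε>0))

infixl 6 _+ᴿ_
infixl 7 _*ᴿ_
infix  8 -ᴿ_

constant : ℚ → ℝ
constant q .seq _ = q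
constant q .cauchy ε ε>0 = 0 , λ _ _ _ _ →
  subst (_<ℚ ε) (sym (cong ∣_∣ (ℚₚ.+-inverseʳ q))) ε>0

0ℝ 1ℝ : ℝ
0ℝ = constant 0ℚ
1ℝ = constant 1ℚ

_+ᴿ_ : ℝ → ℝ → ℝ
(x +ᴿ y) .seq n = seq x n +ℚ seq y n
(x +ᴿ y) .cauchy ε ε>0 =
  map₂ (λ m n (a , b) → close-+ (seq x m) (seq x n) (seq y m) (seq y n) a b)
       (cauchy x _ (half ε>0) ∩₂ cauchy y _ (half ε>0))

-ᴿ_ : ℝ → ℝ
(-ᴿ x) .seq n = -ℚ seq x n
(-ᴿ x) .cauchy ε ε>0 =
  map₂ (λ m n → close-neg (seq x m) (seq x n)) (cauchy x ε ε>0)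

_*ᴿ_ : ℝ → ℝ → ℝ
(x *ᴿ y) .seq n = seq x n *ℚ seq y n
(x *ᴿ y) .cauchy ε ε>0 =
  let (A , A>0 , bx) = bounded x
      (B , B>0 , by) = bounded y
  in map₂ (λ m n ((p , q) , ((_ , a) , (b , _))) →
             close-* ε>0 A A>0 B B>0 (seq x m) (seq x n) (seq y m) (seq y n) a b p q)
          ((cauchy x _ (scale-pos ε>0 B B>0) ∩₂ cauchy y _ (scale-pos ε>0 A A>0))
           ∩₂ (both bx ∩₂ both by))

+ᴿ-cong : ∀ {x x′ y y′} → x ≃ x′ → y ≃ y′ → x +ᴿ y ≃ x′ +ᴿ y′
+ᴿ-cong {x} {x′} {y} {y′} p q .close ε ε>0 =
  mapᵉ (λ n (a , b) → close-+ (seq x n) (seq x′ n) (seq y n) (seq y′ n) a b)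
       (close p _ (half ε>0) ∩ᵉ close q _ (half ε>0))

-ᴿ-cong : ∀ {x x′} → x ≃ x′ → -ᴿ x ≃ -ᴿ x′
-ᴿ-cong {x} {x′} p .close ε ε>0 = mapᵉ (λ n → close-neg (seq x n) (seq x′ n)) (close p ε ε>0)

*ᴿ-cong : ∀ {x x′ y y′} → x ≃ x′ → y ≃ y′ → x *ᴿ y ≃ x′ *ᴿ y′
*ᴿ-cong {x} {x′} {y} {y′} p q .close ε ε>0 =
  let (A , A>0 , bx′) = bounded x′
      (B , B>0 , by)  = bounded y
  in mapᵉ (λ n ((s , t) , (a , b)) →
             close-* ε>0 A A>0 B B>0 (seq x n) (seq x′ n) (seq y n) (seq y′ n) a b s t)
          ((close p _ (scale-pos ε>0 B B>0) ∩ᵉ close q _ (scale-pos ε>0 A A>0)) ∩ᵉ (bx′ ∩ᵉ by))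

-- A positive real x is eventually at least its gap ε, so the maximum
-- with ε only changes finitely many terms.
recip : (x : ℝ) → 0ℝ < x → ℝ
recip x (mk< ε ε>0 ev) = result
  where
  pos : ∀ n → Positive (seq x n ⊔ℚ ε)
  pos n = positive (ℚₚ.<-≤-trans ε>0 (ℚₚ.p≤q⊔p (seq x n) ε))
  ⊔-id : ∀ n → 0ℚ +ℚ ε ≤ℚ seq x n → seq x n ⊔ℚ ε ≡ seq x n
  ⊔-id n le = ℚₚ.p≥q⇒p⊔q≡p (subst (_≤ℚ seq x n) (ℚₚ.+-identityˡ ε) le)
  ηεε>0 : ∀ {η} → 0ℚ <ℚ η → Positive (η *ℚ (ε *ℚ ε))
  ηεε>0 {η} η>0 = ℚₚ.pos*pos⇒pos η {{positive η>0}} (ε *ℚ ε)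
    {{ℚₚ.pos*pos⇒pos ε {{positive ε>0}} ε {{positive ε>0}}}}
  result : ℝ
  result .seq n = recip⁺ (seq x n ⊔ℚ ε) (pos n)
  result .cauchy η η>0 = map₂
    (λ m n (p , (lm , ln)) →
      close-recip (positive ε>0) (positive η>0) _ _ (pos m) (pos n)
        (ℚₚ.p≤q⊔p (seq x m) ε) (ℚₚ.p≤q⊔p (seq x n) ε)
        (subst₂ (λ s t → ∣ s -ℚ t ∣ <ℚ η *ℚ (ε *ℚ ε)) (sym (⊔-id m lm)) (sym (⊔-id n ln)) p))
    (cauchy x (η *ℚ (ε *ℚ ε)) (ℚₚ.positive⁻¹ _ {{ηεε>0 η>0}}) ∩₂ both ev)

recip-inverseˡ : ∀ x (x>0 : 0ℝ < x) → recip x x>0 *ᴿ x ≃ 1ℝ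
recip-inverseˡ x x>0@(mk< ε ε>0 ev) .close η η>0 = mapᵉ
  (λ n le → subst (_<ℚ η) (sym (cong ∣_∣ (trans (cong (_-ℚ 1ℚ) (eq n le)) (ℚₚ.+-inverseʳ 1ℚ)))) η>0) ev
  where
  eq : ∀ n → 0ℚ +ℚ ε ≤ℚ seq x n → seq (recip x x>0) n *ℚ seq x n ≡ 1ℚ
  eq n le = trans
    (cong (seq (recip x x>0) n *ℚ_)
      (sym (ℚₚ.p≥q⇒p⊔q≡p (subst (_≤ℚ seq x n) (ℚₚ.+-identityˡ ε) le))))
    (recip⁺-inverseˡ (seq x n ⊔ℚ ε) (positive (ℚₚ.<-≤-trans ε>0 (ℚₚ.p≤q⊔p (seq x n) ε))))

module Identities where
  private
    infixl 6 _+_ _-_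
    infixl 7 _*_
    infix  8 -_
    _+_ _*_ _-_ : ℚ → ℚ → ℚ
    _+_ = _+ℚ_
    _*_ = _*ℚ_
    _-_ = _-ℚ_
    -_ : ℚ → ℚ
    -_ = -ℚ_

  re-assoc : ∀ a b c d e f → (a * c + - (b * d)) * e + - ((a * d + b * c) * f) ≡ a * (c * e + - (d * f)) + - (b * (c * f + d * e))
  re-assoc = solve 6 (λ a b c d e f → (a :* c :+ :- (b :* d)) :* e :+ :- ((a :* d :+ b :* c) :* f) := a :* (c :* e :+ :- (d :* f)) :+ :- (b :* (c :* f :+ d :* e))) refl

  im-assoc : ∀ a b c d e f → (a * c + - (b * d)) * f + (a * d + b * c) * e ≡ a * (c * f + d * e) + b * (c * e + - (d * f))
  im-assoc = solve 6 (λ a b c d e f → (a :* c :+ :- (b :* d)) :* f :+ (a :* d :+ b :* c) :* e := a :* (c :* f :+ d :* e) :+ b :* (c :* e :+ :- (d :* f))) refl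

  re-idˡ : ∀ a b → 1ℚ * a + - (0ℚ * b) ≡ a
  re-idˡ = solve 2 (λ a b → con 1ℚ :* a :+ :- (con 0ℚ :* b) := a) refl

  im-idˡ : ∀ a b → 1ℚ * b + 0ℚ * a ≡ b
  im-idˡ = solve 2 (λ a b → con 1ℚ :* b :+ con 0ℚ :* a := b) refl

  re-idʳ : ∀ a b → a * 1ℚ + - (b * 0ℚ) ≡ a
  re-idʳ = solve 2 (λ a b → a :* con 1ℚ :+ :- (b :* con 0ℚ) := a) refl

  im-idʳ : ∀ a b → a * 0ℚ + b * 1ℚ ≡ b
  im-idʳ = solve 2 (λ a b → a :* con 0ℚ :+ b :* con 1ℚ := b) refl

  re-distˡ : ∀ a b c d e f → a * (c + e) + - (b * (d + f)) ≡ (a * c + - (b * d)) + (a * e + - (b * f))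
  re-distˡ = solve 6 (λ a b c d e f → a :* (c :+ e) :+ :- (b :* (d :+ f)) := (a :* c :+ :- (b :* d)) :+ (a :* e :+ :- (b :* f))) refl

  im-distˡ : ∀ a b c d e f → a * (d + f) + b * (c + e) ≡ (a * d + b * c) + (a * f + b * e)
  im-distˡ = solve 6 (λ a b c d e f → a :* (d :+ f) :+ b :* (c :+ e) := (a :* d :+ b :* c) :+ (a :* f :+ b :* e)) refl

  re-distʳ : ∀ a b c d e f → (c + e) * a + - ((d + f) * b) ≡ (c * a + - (d * b)) + (e * a + - (f * b))
  re-distʳ = solve 6 (λ a b c d e f → (c :+ e) :* a :+ :- ((d :+ f) :* b) := (c :* a :+ :- (d :* b)) :+ (e :* a :+ :- (f :* b))) refl

  im-distʳ : ∀ a b c d e f → (c + e) * b + (d + f) * a ≡ (c * b + d * a) + (e * b + f * a)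
  im-distʳ = solve 6 (λ a b c d e f → (c :+ e) :* b :+ (d :+ f) :* a := (c :* b :+ d :* a) :+ (e :* b :+ f :* a)) refl

  re-comm : ∀ a b c d → a * c + - (b * d) ≡ c * a + - (d * b)
  re-comm = solve 4 (λ a b c d → a :* c :+ :- (b :* d) := c :* a :+ :- (d :* b)) refl

  im-comm : ∀ a b c d → a * d + b * c ≡ c * b + d * a
  im-comm = solve 4 (λ a b c d → a :* d :+ b :* c := c :* b :+ d :* a) refl

  re-inv : ∀ a b r → (a * r + - ((- b) * 0ℚ)) * a + - ((a * 0ℚ + (- b) * r) * b) ≡ r * (a * a + b * b)
  re-inv = solve 3 (λ a b r → (a :* r :+ :- ((:- b) :* con 0ℚ)) :* a :+ :- ((a :* con 0ℚ :+ (:- b) :* r) :* b) := r :* (a :* a :+ b :* b)) refl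

  im-inv : ∀ a b r → (a * r + - ((- b) * 0ℚ)) * b + (a * 0ℚ + (- b) * r) * a ≡ 0ℚ
  im-inv = solve 3 (λ a b r → (a :* r :+ :- ((:- b) :* con 0ℚ)) :* b :+ (a :* con 0ℚ :+ (:- b) :* r) :* a := con 0ℚ) refl

  norm-* : ∀ a b c d → (a * c + - (b * d)) * (a * c + - (b * d)) + (a * d + b * c) * (a * d + b * c) ≡ (a * a + b * b) * (c * c + d * d)
  norm-* = solve 4 (λ a b c d → (a :* c :+ :- (b :* d)) :* (a :* c :+ :- (b :* d)) :+ (a :* d :+ b :* c) :* (a :* d :+ b :* c) := (a :* a :+ b :* b) :* (c :* c :+ d :* d)) refl

  re-conj-* : ∀ a b → a * a + - ((- b) * b) ≡ a * a + b * b
  re-conj-* = solve 2 (λ a b → a :* a :+ :- ((:- b) :* b) := a :* a :+ b :* b) refl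

  im-conj-* : ∀ a b → a * b + (- b) * a ≡ 0ℚ
  im-conj-* = solve 2 (λ a b → a :* b :+ (:- b) :* a := con 0ℚ) refl

  norm-conj : ∀ a b → a * a + (- b) * (- b) ≡ a * a + b * b
  norm-conj = solve 2 (λ a b → a :* a :+ (:- b) :* (:- b) := a :* a :+ b :* b) refl

  skip-element : ∀ a b → a + - b ≡ a + - (0ℚ + b)
  skip-element = solve 2 (λ a b → a :+ :- b := a :+ :- (con 0ℚ :+ b)) refl

  take-element : ∀ r a b → (1ℚ - r) + (a + - b) ≡ (1ℚ + a) + - (r + b)
  take-element = solve 3 (λ r a b → (con 1ℚ :- r) :+ (a :+ :- b) := (con 1ℚ :+ a) :+ :- (r :+ b)) refl

open Identities

record ℂ : Set where
  no-eta-equality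
  field
    re : ℝ
    im : ℝ

open ℂ public

infix 4 _≈ᶜ_

record _≈ᶜ_ (z w : ℂ) : Set where
  constructor mk≈
  field
    re≃ : re z ≃ re w
    im≃ : im z ≃ im w

open _≈ᶜ_ public

infixl 6 _+ᶜ_ _-ᶜ_
infixl 7 _*ᶜ_
infix  8 -ᶜ_

_+ᶜ_ _*ᶜ_ : ℂ → ℂ → ℂ
(z +ᶜ w) .re = re z +ᴿ re w
(z +ᶜ w) .im = im z +ᴿ im w
(z *ᶜ w) .re = re z *ᴿ re w +ᴿ -ᴿ (im z *ᴿ im w)
(z *ᶜ w) .im = re z *ᴿ im w +ᴿ im z *ᴿ re w

-ᶜ_ conj : ℂ → ℂ
(-ᶜ z) .re = -ᴿ re z
(-ᶜ z) .im = -ᴿ im z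
conj z .re = re z
conj z .im = -ᴿ im z

_-ᶜ_ : ℂ → ℂ → ℂ
z -ᶜ w = z +ᶜ (-ᶜ w)

fromℝ : ℝ → ℂ
fromℝ x .re = x
fromℝ x .im = 0ℝ

0ᶜ 1ᶜ : ℂ
0ᶜ = fromℝ 0ℝ
1ᶜ = fromℝ 1ℝ

pointwiseᶜ : ∀ {z w} → (∀ n → seq (re z) n ≡ seq (re w) n) → (∀ n → seq (im z) n ≡ seq (im w) n) → z ≈ᶜ w
pointwiseᶜ p q = mk≈ (pointwise p) (pointwise q)

+ᶜ-cong : ∀ {z z′ w w′} → z ≈ᶜ z′ → w ≈ᶜ w′ → z +ᶜ w ≈ᶜ z′ +ᶜ w′
+ᶜ-cong (mk≈ p q) (mk≈ r s) = mk≈ (+ᴿ-cong p r) (+ᴿ-cong q s)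

-ᶜ-cong : ∀ {z z′} → z ≈ᶜ z′ → -ᶜ z ≈ᶜ -ᶜ z′
-ᶜ-cong (mk≈ p q) = mk≈ (-ᴿ-cong p) (-ᴿ-cong q)

conj-cong : ∀ {z z′} → z ≈ᶜ z′ → conj z ≈ᶜ conj z′
conj-cong (mk≈ p q) = mk≈ p (-ᴿ-cong q)

*ᶜ-cong : ∀ {z z′ w w′} → z ≈ᶜ z′ → w ≈ᶜ w′ → z *ᶜ w ≈ᶜ z′ *ᶜ w′
*ᶜ-cong (mk≈ p q) (mk≈ r s) = mk≈
  (+ᴿ-cong (*ᴿ-cong p r) (-ᴿ-cong (*ᴿ-cong q s)))
  (+ᴿ-cong (*ᴿ-cong p s) (*ᴿ-cong q r))

≈ᶜ-isEquivalence : IsEquivalence _≈ᶜ_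
≈ᶜ-isEquivalence = record
  { refl  = mk≈ ≃-refl ≃-refl
  ; sym   = λ (mk≈ p q) → mk≈ (≃-sym p) (≃-sym q)
  ; trans = λ (mk≈ p q) (mk≈ r s) → mk≈ (≃-trans p r) (≃-trans q s)
  }

ℂ-isCommutativeRing : IsCommutativeRing _≈ᶜ_ _+ᶜ_ _*ᶜ_ -ᶜ_ 0ᶜ 1ᶜ
ℂ-isCommutativeRing = record
  { isRing = record
    { +-isAbelianGroup = record
      { isGroup = record
        { isMonoid = record
          { isSemigroup = record
            { isMagma = record { isEquivalence = ≈ᶜ-isEquivalence ; ∙-cong = +ᶜ-cong }
            ; assoc = λ x y z → pointwiseᶜ
                (λ n → ℚₚ.+-assoc (seq (re x) n) (seq (re y) n) (seq (re z) n))
                (λ n → ℚₚ.+-assoc (seq (im x) n) (seq (im y) n) (seq (im z) n))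
            }
          ; identity = (λ x → pointwiseᶜ (λ n → ℚₚ.+-identityˡ (seq (re x) n)) (λ n → ℚₚ.+-identityˡ (seq (im x) n)))
                     , (λ x → pointwiseᶜ (λ n → ℚₚ.+-identityʳ (seq (re x) n)) (λ n → ℚₚ.+-identityʳ (seq (im x) n)))
          }
        ; inverse = (λ x → pointwiseᶜ (λ n → ℚₚ.+-inverseˡ (seq (re x) n)) (λ n → ℚₚ.+-inverseˡ (seq (im x) n)))
                  , (λ x → pointwiseᶜ (λ n → ℚₚ.+-inverseʳ (seq (re x) n)) (λ n → ℚₚ.+-inverseʳ (seq (im x) n)))
        ; ⁻¹-cong = -ᶜ-cong
        }
      ; comm = λ x y → pointwiseᶜ (λ n → ℚₚ.+-comm (seq (re x) n) (seq (re y) n)) (λ n → ℚₚ.+-comm (seq (im x) n) (seq (im y) n))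
      }
    ; *-cong = *ᶜ-cong
    ; *-assoc = λ x y z → pointwiseᶜ
        (λ n → re-assoc (seq (re x) n) (seq (im x) n) (seq (re y) n) (seq (im y) n) (seq (re z) n) (seq (im z) n))
        (λ n → im-assoc (seq (re x) n) (seq (im x) n) (seq (re y) n) (seq (im y) n) (seq (re z) n) (seq (im z) n))
    ; *-identity = (λ x → pointwiseᶜ
                       (λ n → re-idˡ (seq (re x) n) (seq (im x) n))
                       (λ n → im-idˡ (seq (re x) n) (seq (im x) n)))
                 , (λ x → pointwiseᶜ
                       (λ n → re-idʳ (seq (re x) n) (seq (im x) n))
                       (λ n → im-idʳ (seq (re x) n) (seq (im x) n)))
    ; distrib = (λ x y z → pointwiseᶜ
                    (λ n → re-distˡ (seq (re x) n) (seq (im x) n) (seq (re y) n) (seq (im y) n) (seq (re z) n) (seq (im z) n))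
                    (λ n → im-distˡ (seq (re x) n) (seq (im x) n) (seq (re y) n) (seq (im y) n) (seq (re z) n) (seq (im z) n)))
              , (λ x y z → pointwiseᶜ
                    (λ n → re-distʳ (seq (re x) n) (seq (im x) n) (seq (re y) n) (seq (im y) n) (seq (re z) n) (seq (im z) n))
                    (λ n → im-distʳ (seq (re x) n) (seq (im x) n) (seq (re y) n) (seq (im y) n) (seq (re z) n) (seq (im z) n)))
    }
  ; *-comm = λ x y → pointwiseᶜ
      (λ n → re-comm (seq (re x) n) (seq (im x) n) (seq (re y) n) (seq (im y) n))
      (λ n → im-comm (seq (re x) n) (seq (im x) n) (seq (re y) n) (seq (im y) n))
  }

ℂ-commutativeRing : CommutativeRing 0ℓ 0ℓ
ℂ-commutativeRing = record { isCommutativeRing = ℂ-isCommutativeRing }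

module ℂR = CommutativeRing ℂ-commutativeRing

open RawMonoidOps ℂR.+-rawMonoid public using () renaming (sum to sumᶜ; _×_ to _·ᶜ_)

sumᶜ-cong : ∀ {n} {f g : Fin n → ℂ} → (∀ i → f i ≈ᶜ g i) → sumᶜ f ≈ᶜ sumᶜ g
sumᶜ-cong {zero}  p = ℂR.refl
sumᶜ-cong {suc n} p = ℂR.+-cong (p zero) (sumᶜ-cong (p ∘ suc))

fromℕ : ℕ → ℂ
fromℕ n = n ·ᶜ 1ᶜ

∣_∣² : ℂ → ℝ
∣ z ∣² = re z *ᴿ re z +ᴿ im z *ᴿ im z

-- Constructively, inverting z requires |z| > 0, not just ¬ (z ≈ᶜ 0ᶜ).
_≉0 : ℂ → Set
z ≉0 = 0ℝ < ∣ z ∣²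

inv : (z : ℂ) → z ≉0 → ℂ
inv z z≉0 = conj z *ᶜ fromℝ (recip ∣ z ∣² z≉0)

inv-inverseˡ : ∀ z z≉0 → inv z z≉0 *ᶜ z ≈ᶜ 1ᶜ
inv-inverseˡ z z≉0 = ℂR.trans {j = fromℝ (r *ᴿ ∣ z ∣²)}
  (pointwiseᶜ
    (λ n → re-inv (seq (re z) n) (seq (im z) n) (seq r n))
    (λ n → im-inv (seq (re z) n) (seq (im z) n) (seq r n)))
  (mk≈ (recip-inverseˡ ∣ z ∣² z≉0) ≃-refl)
  where r = recip ∣ z ∣² z≉0

-- |z| = 1 is expressed as |z|² = 1, which avoids the square root.
record Circle : Set where
  constructor mkCircle
  field
    val     : ℂ
    modulus : ∣ val ∣² ≃ 1ℝ

open Circle public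

∣∣²-* : ∀ z w → ∣ z *ᶜ w ∣² ≃ ∣ z ∣² *ᴿ ∣ w ∣²
∣∣²-* z w = pointwise λ n →
  norm-* (seq (re z) n) (seq (im z) n) (seq (re w) n) (seq (im w) n)

conj-* : ∀ z → conj z *ᶜ z ≈ᶜ fromℝ ∣ z ∣²
conj-* z = pointwiseᶜ
  (λ n → re-conj-* (seq (re z) n) (seq (im z) n))
  (λ n → im-conj-* (seq (re z) n) (seq (im z) n))

𝕋 : AbelianGroup 0ℓ 0ℓ
𝕋 = record
  { Carrier = Circle
  ; _≈_ = λ u v → val u ≈ᶜ val v
  ; _∙_ = λ u v → mkCircle (val u *ᶜ val v)
      (≃-trans (∣∣²-* (val u) (val v))
        (≃-trans (*ᴿ-cong (modulus u) (modulus v)) (pointwise λ _ → ℚₚ.*-identityˡ 1ℚ)))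
  ; ε = mkCircle 1ᶜ (pointwise λ _ → refl)
  ; _⁻¹ = λ u → mkCircle (conj (val u)) (≃-trans
      (pointwise λ n → norm-conj (seq (re (val u)) n) (seq (im (val u)) n))
      (modulus u))
  ; isAbelianGroup = record
    { isGroup = record
      { isMonoid = record
        { isSemigroup = record
          { isMagma = record
            { isEquivalence = record { refl = ℂR.refl ; sym = ℂR.sym ; trans = ℂR.trans }
            ; ∙-cong = ℂR.*-cong
            }
          ; assoc = λ u v w → ℂR.*-assoc (val u) (val v) (val w)
          }
        ; identity = (λ u → ℂR.*-identityˡ (val u)) , (λ u → ℂR.*-identityʳ (val u))
        }
      ; inverse = conj-inverse , λ u → ℂR.trans (ℂR.*-comm (val u) (conj (val u))) (conj-inverse u)
      ; ⁻¹-cong = conj-cong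
      }
    ; comm = λ u v → ℂR.*-comm (val u) (val v)
    }
  }
  where
  conj-inverse : ∀ u → conj (val u) *ᶜ val u ≈ᶜ 1ᶜ
  conj-inverse u = ℂR.trans (conj-* (val u)) (mk≈ (modulus u) ≃-refl)

record Finite {a ℓ} (A : Setoid a ℓ) : Set (a ⊔ ℓ) where
  field
    size        : ℕ
    enumeration : Inverse (≡.setoid (Fin size)) A

  open Inverse enumeration public using () renaming (to to element; from to index)

∑[_]_ : ∀ {a ℓ} {A : Setoid a ℓ} → Finite A → (Setoid.Carrier A → ℂ) → ℂ
∑[ fin ] h = sumᶜ (λ i → h (Finite.element fin i))

∑-cong : ∀ {a ℓ} {A : Setoid a ℓ} (fin : Finite A) (h h′ : Setoid.Carrier A → ℂ) →
         (∀ a → h a ≈ᶜ h′ a) → ∑[ fin ] h ≈ᶜ ∑[ fin ] h′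
∑-cong fin h h′ p = sumᶜ-cong λ i → p (Finite.element fin i)

record FiniteAbelianGroup c ℓ : Set (lsuc (c ⊔ ℓ)) where
  field
    abelianGroup : AbelianGroup c ℓ
    finite       : Finite (AbelianGroup.setoid abelianGroup)

  open AbelianGroup abelianGroup public
  open Finite finite public using (element; index) renaming (size to order)

  order-nonZero : ℕ.NonZero order
  order-nonZero with order | index ε
  ... | suc _ | _ = _

-- Membership is decidable so that |S| is a natural number and sums over S
-- make sense; classically this is no restriction.
record SymmetricSubset {c ℓ} (G : FiniteAbelianGroup c ℓ) (p : Level) : Set (c ⊔ ℓ ⊔ lsuc p) where
  open FiniteAbelianGroup G
  field
    _∈S       : Pred Carrier p
    _∈S?      : Decidable _∈S
    respects  : ∀ {g h} → g ≈ h → g ∈S → h ∈S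
    symmetric : ∀ {g} → g ∈S → (g ⁻¹) ∈S

  card : ℕ
  card = length (filter _∈S? (tabulate element))

module _ {c ℓ} (G : FiniteAbelianGroup c ℓ) where
  private module G = FiniteAbelianGroup G

  record Character : Set (c ⊔ ℓ) where
    open GroupMorphisms G.rawGroup (AbelianGroup.rawGroup 𝕋)
    field
      ⟦_⟧                 : G.Carrier → Circle
      isGroupHomomorphism : IsGroupHomomorphism ⟦_⟧

    open IsGroupHomomorphism isGroupHomomorphism public

    value : G.Carrier → ℂ
    value g = val (⟦_⟧ g)

  dual : Setoid (c ⊔ ℓ) c
  dual = record
    { Carrier = Character
    ; _≈_ = λ χ ψ → ∀ g → Character.value χ g ≈ᶜ Character.value ψ g
    ; isEquivalence = record
      { refl  = λ g → ℂR.refl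
      ; sym   = λ p g → ℂR.sym (p g)
      ; trans = λ p q g → ℂR.trans (p g) (q g)
      }
    }

  ℓ² : Setoid (c ⊔ ℓ) c
  ℓ² = FunctionSetoid.setoid G.setoid ℂR.setoid

NonNeg : (ℕ → ℚ) → Set
NonNeg x = ∀ ε → 0ℚ <ℚ ε → Eventually (λ n → -ℚ ε ≤ℚ x n)

nonNeg-resp : ∀ {x y : ℕ → ℚ} → (∀ n → x n ≡ y n) → NonNeg x → NonNeg y
nonNeg-resp eq p ε ε>0 = mapᵉ (λ n → subst (-ℚ ε ≤ℚ_) (eq n)) (p ε ε>0)

nonNeg-+ : ∀ {x y} → NonNeg x → NonNeg y → NonNeg (λ n → x n +ℚ y n)
nonNeg-+ {x} {y} p q ε ε>0 =
  mapᵉ (λ n (a , b) → subst (_≤ℚ x n +ℚ y n) -½ε (ℚₚ.+-mono-≤ a b))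
       (p _ (half ε>0) ∩ᵉ q _ (half ε>0))
  where
  -½ε : (-ℚ (½ *ℚ ε)) +ℚ (-ℚ (½ *ℚ ε)) ≡ -ℚ ε
  -½ε = solve 1 (λ e → (:- (con ½ :* e)) :+ (:- (con ½ :* e)) := :- e) refl ε

square≥0 : ∀ b → 0ℚ ≤ℚ b *ℚ b
square≥0 b with ℚₚ.≤-total 0ℚ b
... | inj₁ 0≤b = subst (_≤ℚ b *ℚ b) (ℚₚ.*-zeroˡ b) (ℚₚ.*-monoʳ-≤-nonNeg b {{nonNegative 0≤b}} 0≤b)
... | inj₂ b≤0 = subst (_≤ℚ b *ℚ b) (ℚₚ.*-zeroˡ b) (ℚₚ.*-monoʳ-≤-nonPos b {{nonPositive b≤0}} b≤0)

p≤∣p∣ : ∀ p → p ≤ℚ ∣ p ∣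
p≤∣p∣ p with ℚₚ.≤-total 0ℚ p
... | inj₁ 0≤p = ℚₚ.≤-reflexive (sym (ℚₚ.0≤p⇒∣p∣≡p 0≤p))
... | inj₂ p≤0 = ℚₚ.≤-trans p≤0 (ℚₚ.0≤∣p∣ p)

1-re-nonNeg : (u : Circle) → NonNeg (λ n → 1ℚ -ℚ seq (re (val u)) n)
1-re-nonNeg u ε ε>0 = mapᵉ (λ n → bound (seq (re (val u)) n) (seq (im (val u)) n)) (close (modulus u) ε ε>0)
  where
  open ℚₚ.≤-Reasoning
  1+ε = 1ℚ +ℚ ε
  1+ε>0 : Positive 1+ε
  1+ε>0 = ℚₚ.pos+pos⇒pos 1ℚ ε {{positive ε>0}}
  bound : ∀ a b → ∣ (a *ℚ a +ℚ b *ℚ b) -ℚ 1ℚ ∣ <ℚ ε → -ℚ ε ≤ℚ 1ℚ -ℚ a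
  bound a b p with a ℚₚ.≤? 1+ε
  ... | yes a≤1+ε = begin
    -ℚ ε          ≡⟨ solve 1 (λ e → :- e := con 1ℚ :- (con 1ℚ :+ e)) refl ε ⟩
    1ℚ -ℚ 1+ε     ≤⟨ ℚₚ.+-monoʳ-≤ 1ℚ (ℚₚ.neg-antimono-≤ a≤1+ε) ⟩
    1ℚ -ℚ a       ∎
  ... | no a≰1+ε = contradiction (begin-strict
    1+ε                                        ≡⟨ ℚₚ.*-identityʳ 1+ε ⟨
    1+ε *ℚ 1ℚ                                  ≡⟨ cong (1+ε *ℚ_) (ℚₚ.+-identityʳ 1ℚ) ⟨
    1+ε *ℚ (1ℚ +ℚ 0ℚ)                          <⟨ ℚₚ.*-monoʳ-<-pos 1+ε {{1+ε>0}} (ℚₚ.+-monoʳ-< 1ℚ ε>0) ⟩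
    1+ε *ℚ 1+ε                                 <⟨ ℚₚ.*-monoʳ-<-pos 1+ε {{1+ε>0}} a>1+ε ⟩
    1+ε *ℚ a                                   <⟨ ℚₚ.*-monoˡ-<-pos a {{positive (ℚₚ.<-trans (ℚₚ.positive⁻¹ 1+ε {{1+ε>0}}) a>1+ε)}} a>1+ε ⟩
    a *ℚ a                                     ≡⟨ ℚₚ.+-identityʳ (a *ℚ a) ⟨
    a *ℚ a +ℚ 0ℚ                               ≤⟨ ℚₚ.+-monoʳ-≤ (a *ℚ a) (square≥0 b) ⟩
    a *ℚ a +ℚ b *ℚ b                           ≡⟨ solve 1 (λ t → t := con 1ℚ :+ (t :- con 1ℚ)) refl (a *ℚ a +ℚ b *ℚ b) ⟩
    1ℚ +ℚ ((a *ℚ a +ℚ b *ℚ b) -ℚ 1ℚ)           ≤⟨ ℚₚ.+-monoʳ-≤ 1ℚ (p≤∣p∣ ((a *ℚ a +ℚ b *ℚ b) -ℚ 1ℚ)) ⟩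
    1ℚ +ℚ ∣ (a *ℚ a +ℚ b *ℚ b) -ℚ 1ℚ ∣         <⟨ ℚₚ.+-monoʳ-< 1ℚ p ⟩
    1+ε                                        ∎) (ℚₚ.<-irrefl refl)
    where
    a>1+ε : 1+ε <ℚ a
    a>1+ε = ℚₚ.≰⇒> a≰1+ε

positive-re⇒≉0 : ∀ z → 0ℝ < re z → z ≉0
positive-re⇒≉0 z (mk< ε ε>0 ev) = mk< (ε *ℚ ε) (ℚₚ.positive⁻¹ _ {{ε²>0}})
  (mapᵉ (λ n → bound (seq (re z) n) (seq (im z) n)) ev)
  where
  open ℚₚ.≤-Reasoning
  ε²>0 : Positive (ε *ℚ ε)
  ε²>0 = ℚₚ.pos*pos⇒pos ε {{positive ε>0}} ε {{positive ε>0}}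
  bound : ∀ a b → 0ℚ +ℚ ε ≤ℚ a → 0ℚ +ℚ ε *ℚ ε ≤ℚ a *ℚ a +ℚ b *ℚ b
  bound a b p = begin
    0ℚ +ℚ ε *ℚ ε         ≡⟨ ℚₚ.+-identityˡ _ ⟩
    ε *ℚ ε               ≤⟨ ℚₚ.*-monoˡ-≤-nonNeg ε {{nonNegative (ℚₚ.<⇒≤ ε>0)}} ε≤a ⟩
    ε *ℚ a               ≤⟨ ℚₚ.*-monoʳ-≤-nonNeg a {{nonNegative (ℚₚ.≤-trans (ℚₚ.<⇒≤ ε>0) ε≤a)}} ε≤a ⟩
    a *ℚ a               ≡⟨ ℚₚ.+-identityʳ (a *ℚ a) ⟨
    a *ℚ a +ℚ 0ℚ         ≤⟨ ℚₚ.+-monoʳ-≤ (a *ℚ a) (square≥0 b) ⟩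
    a *ℚ a +ℚ b *ℚ b     ∎
    where
    ε≤a : ε ≤ℚ a
    ε≤a = subst (_≤ℚ a) (ℚₚ.+-identityˡ ε) p

nonNeg+positive : ∀ z (α : ℝ) → NonNeg (seq (re z)) → 0ℝ < α → 0ℝ < re (z +ᶜ fromℝ α)
nonNeg+positive z α p (mk< ε ε>0 ev) = mk< (½ *ℚ ε) (half ε>0)
  (mapᵉ (λ n (a , b) → subst (_≤ℚ seq (re z) n +ℚ seq α n) eq (ℚₚ.+-mono-≤ a b))
        (p _ (half ε>0) ∩ᵉ ev))
  where
  eq : (-ℚ (½ *ℚ ε)) +ℚ (0ℚ +ℚ ε) ≡ 0ℚ +ℚ ½ *ℚ ε
  eq = solve 1 (λ e → (:- (con ½ :* e)) :+ (con 0ℚ :+ e) := con 0ℚ :+ con ½ :* e) refl ε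

module Diffusion {c ℓ p} (G : FiniteAbelianGroup c ℓ) (S : SymmetricSubset G p) where
  private module G = FiniteAbelianGroup G
  open G using (_∙_; _⁻¹; order; element)
  open SymmetricSubset S

  Fun : Set (c ⊔ ℓ)
  Fun = Setoid.Carrier (ℓ² G)

  k : ℂ
  k = fromℕ card

  δS : G.Carrier → ℂ
  δS g = if does (g ∈S?) then 1ᶜ else 0ᶜ

  -- S is indexed as a part of the enumeration of G, which lists every
  -- element exactly once.
  ∑S : (G.Carrier → ℂ) → ℂ
  ∑S h = ∑[ G.finite ] λ g → if does (g ∈S?) then h g else 0ᶜ

  infixl 7 _∗_
  _∗_ : (G.Carrier → ℂ) → (G.Carrier → ℂ) → G.Carrier → ℂ
  (f ∗ g) x = ∑[ G.finite ] λ y → f y *ᶜ g (y ⁻¹ ∙ x)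

  -- Substituting z = y⁻¹x, (δS ∗ f)(x) is the sum of f(z) over the z with
  -- x z⁻¹ ∈ S, i.e. over the neighbours of x in the Cayley graph X(G,S).
  laplacian : (G.Carrier → ℂ) → G.Carrier → ℂ
  laplacian f x = k *ᶜ f x -ᶜ (δS ∗ f) x

  L : Fun → Fun
  L f = record
    { to   = laplacian (f ⟨$⟩_)
    ; cong = λ {x} {x′} x≈x′ → +ᶜ-cong
        (*ᶜ-cong (ℂR.refl {k}) (Func.cong f x≈x′))
        (-ᶜ-cong (∑-cong G.finite
          (λ y → δS y *ᶜ (f ⟨$⟩ (y ⁻¹ ∙ x))) (λ y → δS y *ᶜ (f ⟨$⟩ (y ⁻¹ ∙ x′)))
          (λ y → *ᶜ-cong (ℂR.refl {δS y}) (Func.cong f (G.∙-congˡ x≈x′)))))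
    }

  H₀ : ℝ → Fun → Fun
  H₀ α₀ f = record
    { to   = λ x → (L f ⟨$⟩ x) +ᶜ fromℝ α₀ *ᶜ (f ⟨$⟩ x)
    ; cong = λ x≈x′ → +ᶜ-cong (Func.cong (L f) x≈x′) (*ᶜ-cong (ℂR.refl {fromℝ α₀}) (Func.cong f x≈x′))
    }

  eigenvalue : Character G → ℂ
  eigenvalue χ = k -ᶜ ∑S (λ s → conj (Character.value χ s))

  -- |χ(s)| = 1 gives Re χ ≤ 1, hence Re λ_χ = Σ_{s∈S} (1 - Re χ(s)) ≥ 0.
  eigenvalue-nonNeg : ∀ χ → NonNeg (seq (re (eigenvalue χ)))
  eigenvalue-nonNeg χ = partial order element
    where
    v : G.Carrier → ℂ
    v g = conj (Character.value χ g)
    count total : ∀ n (e : Fin n → G.Carrier) → ℂ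
    count n e = fromℕ (length (filter _∈S? (tabulate e)))
    total n e = sumᶜ (λ i → if does (e i ∈S?) then v (e i) else 0ᶜ)
    partial : ∀ n (e : Fin n → G.Carrier) → NonNeg (seq (re (count n e -ᶜ total n e)))
    partial zero    e ε ε>0 = 0 , λ _ _ → ℚₚ.neg-antimono-≤ (ℚₚ.<⇒≤ ε>0)
    partial (suc n) e with does (e zero ∈S?)
    ... | false = nonNeg-resp
      (λ m → skip-element (seq (re (count n (e ∘ suc))) m) (seq (re (total n (e ∘ suc))) m))
      (partial n (e ∘ suc))
    ... | true  = nonNeg-resp
      (λ m → take-element (seq (re (v (e zero))) m)
               (seq (re (count n (e ∘ suc))) m) (seq (re (total n (e ∘ suc))) m))
      (nonNeg-+ (1-re-nonNeg (Character.⟦_⟧ χ (e zero))) (partial n (e ∘ suc)))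

  eigenvalue+α₀≉0 : ∀ χ {α₀} → 0ℝ < α₀ → (eigenvalue χ +ᶜ fromℝ α₀) ≉0
  eigenvalue+α₀≉0 χ {α₀} α₀>0 =
    positive-re⇒≉0 (eigenvalue χ +ᶜ fromℝ α₀) (nonNeg+positive (eigenvalue χ) α₀ (eigenvalue-nonNeg χ) α₀>0)

  1/∣G∣ : ℂ
  1/∣G∣ = fromℝ (constant ((+ 1 /ℚ order) {{G.order-nonZero}}))

  -- Since ∑_x |χ(x)|² = |G|, the spectral expansion of H₀⁻¹ over unnormalised
  -- characters carries the factor 1/|G|.  Without it the formula already fails
  -- for S = ∅ and α₀ = 1, where H₀ is the identity and the double sum is |G| f(x).
  green : {α₀ : ℝ} → 0ℝ < α₀ → Finite (dual G) → Fun → Fun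
  green {α₀} α₀>0 Ĝ f = record
    { to   = λ x → 1/∣G∣ *ᶜ ∑[ Ĝ ] λ χ → ∑[ G.finite ] λ y → term χ y x
    ; cong = λ {x} {x′} x≈x′ → *ᶜ-cong (ℂR.refl {1/∣G∣})
        (∑-cong Ĝ (λ χ → ∑[ G.finite ] λ y → term χ y x) (λ χ → ∑[ G.finite ] λ y → term χ y x′) λ χ →
          ∑-cong G.finite (λ y → term χ y x) (λ y → term χ y x′) λ y →
            *ᶜ-cong (ℂR.refl {weight χ y}) (Character.⟦⟧-cong χ x≈x′))
    }
    where
    weight : Character G → G.Carrier → ℂ
    weight χ y = inv (eigenvalue χ +ᶜ fromℝ α₀) (eigenvalue+α₀≉0 χ α₀>0)
                   *ᶜ (f ⟨$⟩ y) *ᶜ conj (Character.value χ y)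
    term : Character G → G.Carrier → G.Carrier → ℂ
    term χ y x = weight χ y *ᶜ Character.value χ x

-- Every character χ is an eigenvector of H₀ with eigenvalue λ_χ + α₀, and f ↦ ∑ f χ̄ turns H₀ into
-- multiplication by the same number, so both compositions of H₀ with the Green's function reduce
-- to Fourier inversion on G, which is the orthogonality relation ∑_χ χ(z) = |G| [z = ε].
--
-- Constructively, all of this rests on a primitive |G|-th root of unity η and on ℂ being a local
-- ring. With c = cot θ the argument of (c + i)ᵈ is dθ, and bisection on rational c locates
-- θ = π/n, whence η = (c + i)/(c - i) has order n. Locality makes "some term of an invertible sum
-- is invertible" available, so that discrete Fourier transforms along cyclic orbits decide which
-- power of η a given root of unity is, and split a function on G into joint eigenvectors of all
-- translations. Such an eigenvector is a multiple of a character; starting from δ_ε - T δ_ε, where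
-- T is the translation by z, one obtains a character that separates z from ε. Finally, characters
-- correspond to certain functions G → ℤ/|G|, so there are finitely many of them.
module Submission where

open import Defs
open import Algebra.Bundles using (AbelianGroup; CommutativeMonoid; CommutativeRing)
import Algebra.Properties.CommutativeMonoid.Sum as CommutativeMonoidSum
import Algebra.Properties.Group as GroupProperties
open import Data.Bool.Base using (true; false; if_then_else_)
open import Data.Fin.Base as Fin using (Fin; toℕ; punchIn; finToFun; funToFin)
import Data.Fin.Properties as Finₚ
open import Data.List.Base using (lookup; length; deduplicate; tabulate)
open import Data.List.Membership.Propositional.Properties using (∈-lookup)
open import Data.List.Relation.Unary.All as All using (All)
import Data.List.Relation.Unary.AllPairs as AllPairs
open import Data.List.Relation.Unary.Any as Any using (Any)
import Data.List.Relation.Unary.Any.Properties as Anyₚ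
open import Data.List.Relation.Unary.Unique.DecSetoid.Properties using (deduplicate-!)
import Data.List.Relation.Unary.Unique.Setoid as UniqueSetoid
open import Data.Nat.Base as ℕ using (ℕ; zero; suc)
import Data.Nat.Properties as ℕₚ
open import Data.Product.Base using (∃; ∃₂; _×_; _,_; proj₁; proj₂)
open import Data.Sum.Base using (_⊎_; inj₁; inj₂; [_,_]′)
open import Function.Base using (_∘_)
open import Function.Bundles using (Inverse; Func; _⟨$⟩_)
import Function.Construct.Composition as Composition
import Function.Construct.Symmetry as Symmetry
open import Function.Definitions using (Inverseᵇ)
open import Level using (_⊔_)
open import Relation.Binary.Bundles using (DecSetoid; Setoid)
open import Relation.Binary.Definitions using () renaming (Decidable to Decidable₂)
open import Relation.Binary.PropositionalEquality as ≡ using (_≡_)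
open import Relation.Nullary using (¬_; Dec; yes; no; contradiction; does)
open import Relation.Nullary.Decidable using (map′; dec-true; dec-false)

module Units {c ℓ} (R : CommutativeRing c ℓ) where
  open CommutativeRing R hiding (zero)
  open import Algebra.Definitions.RawMagma *-rawMagma public using (_∣_; _,_)
  open import Algebra.Properties.CommutativeMagma.Divisibility *-commutativeMagma using (x∣xy)
  open import Algebra.Properties.Semigroup.Divisibility *-semigroup using (∣ʳ-trans; ∣ʳ-respˡ-≈)
  open import Algebra.Properties.Group +-group using (x≈y⇒x∙y⁻¹≈ε; ∙-cancelˡ)
  open import Algebra.Properties.AbelianGroup +-abelianGroup using (xyx⁻¹≈y; ⁻¹-anti-homo‿-)
  open import Algebra.Properties.CommutativeSemigroup *-commutativeSemigroup using (x∙yz≈y∙xz)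
  open import Algebra.Properties.Ring ring using ([y-z]x≈yx-zx; x[y-z]≈xy-xz; -‿distribˡ-*; -‿distribʳ-*)
  open import Algebra.Properties.Semiring.Sum semiring
  open import Algebra.Properties.Semiring.Mult semiring using () renaming (_×_ to _·_)
  open import Algebra.Properties.CommutativeSemiring.Exp commutativeSemiring
  open import Relation.Binary.Reasoning.Setoid setoid

  Unit : Carrier → Set (c ⊔ ℓ)
  Unit x = x ∣ 1#

  unit-resp-≈ : ∀ {x y} → x ≈ y → Unit x → Unit y
  unit-resp-≈ = ∣ʳ-respˡ-≈

  unit-factorˡ : ∀ {x y} → Unit (x * y) → Unit x
  unit-factorˡ {x} {y} = ∣ʳ-trans (x∣xy x y)

  unit-factorʳ : ∀ {x y} → Unit (x * y) → Unit y
  unit-factorʳ {x} {y} u = unit-factorˡ (unit-resp-≈ (*-comm x y) u)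

  unit-* : ∀ {x y} → Unit x → Unit y → Unit (x * y)
  unit-* {x} {y} (p , px≈1) (q , qy≈1) = p * q , (begin
    p * q * (x * y)    ≈⟨ *-assoc p q (x * y) ⟩
    p * (q * (x * y))  ≈⟨ *-congˡ (*-congˡ (*-comm x y)) ⟩
    p * (q * (y * x))  ≈⟨ *-congˡ (*-assoc q y x) ⟨
    p * (q * y * x)    ≈⟨ *-congˡ (trans (*-congʳ qy≈1) (*-identityˡ x)) ⟩
    p * x              ≈⟨ px≈1 ⟩
    1#                 ∎)

  unit-1 : Unit 1#
  unit-1 = 1# , *-identityˡ 1#

  unit-^ : ∀ {x} n → Unit x → Unit (x ^ n)
  unit-^ zero    u = unit-1
  unit-^ (suc n) u = unit-* u (unit-^ n u)

  unit-cancelˡ : ∀ {s x y} → Unit s → s * x ≈ s * y → x ≈ y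
  unit-cancelˡ {s} {x} {y} (q , qs≈1) sx≈sy = begin
    x            ≈⟨ undo x ⟨
    q * (s * x)  ≈⟨ *-congˡ sx≈sy ⟩
    q * (s * y)  ≈⟨ undo y ⟩
    y            ∎
    where
    undo : ∀ z → q * (s * z) ≈ z
    undo z = trans (sym (*-assoc q s z)) (trans (*-congʳ qs≈1) (*-identityˡ z))

  unit-cancelʳ : ∀ {s x y} → Unit s → x * s ≈ y * s → x ≈ y
  unit-cancelʳ {s} {x} {y} u xs≈ys =
    unit-cancelˡ u (trans (*-comm s x) (trans xs≈ys (*-comm y s)))

  fixed⇒≈1 : ∀ {u s} → Unit s → u * s ≈ s → u ≈ 1#
  fixed⇒≈1 unit us≈s = unit-cancelʳ unit (trans us≈s (sym (*-identityˡ _)))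

  fixed⇒≈0 : ∀ {u s} → Unit (u - 1#) → u * s ≈ s → s ≈ 0#
  fixed⇒≈0 {u} {s} unit us≈s = unit-cancelˡ unit (begin
    (u - 1#) * s      ≈⟨ [y-z]x≈yx-zx s u 1# ⟩
    u * s - 1# * s    ≈⟨ x≈y⇒x∙y⁻¹≈ε (trans us≈s (sym (*-identityˡ s))) ⟩
    0#                ≈⟨ zeroʳ (u - 1#) ⟨
    (u - 1#) * 0#     ∎)

  ∑<[_]_ : ℕ → (ℕ → Carrier) → Carrier
  ∑<[ n ] f = sum {n} (f ∘ toℕ)

  ∑<-telescope : ∀ n f → f 0 + ∑<[ n ] (f ∘ suc) ≈ ∑<[ n ] f + f n
  ∑<-telescope zero    f = trans (+-identityʳ (f 0)) (sym (+-identityˡ (f 0)))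
  ∑<-telescope (suc n) f = begin
    f 0 + (f 1 + ∑<[ n ] (f ∘ suc ∘ suc))   ≈⟨ +-congˡ (∑<-telescope n (f ∘ suc)) ⟩
    f 0 + (∑<[ n ] (f ∘ suc) + f (suc n))   ≈⟨ +-assoc _ _ _ ⟨
    f 0 + ∑<[ n ] (f ∘ suc) + f (suc n)     ∎

  ∑<-shift : ∀ n f → f n ≈ f 0 → ∑<[ n ] (f ∘ suc) ≈ ∑<[ n ] f
  ∑<-shift n f fn≈f0 = ∙-cancelˡ (f 0) _ _ (begin
    f 0 + ∑<[ n ] (f ∘ suc)  ≈⟨ ∑<-telescope n f ⟩
    ∑<[ n ] f + f n          ≈⟨ +-congˡ fn≈f0 ⟩
    ∑<[ n ] f + f 0          ≈⟨ +-comm _ _ ⟩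
    f 0 + ∑<[ n ] f          ∎)

  ∑<-head : ∀ {n} → 0 ℕ.< n → ∀ f → (∀ k → 0 ℕ.< k → k ℕ.< n → f k ≈ 0#) → ∑<[ n ] f ≈ f 0
  ∑<-head {suc n} _ f f≈0 = trans
    (+-congˡ (trans (sum-cong-≋ {n} (λ k → f≈0 (suc (toℕ k)) (ℕ.s≤s ℕ.z≤n) (ℕ.s≤s (Finₚ.toℕ<n k))))
                    (sum-replicate-zero n)))
    (+-identityʳ (f 0))

  1^n≈1 : ∀ n → 1# ^ n ≈ 1#
  1^n≈1 zero    = refl
  1^n≈1 (suc n) = trans (*-identityˡ (1# ^ n)) (1^n≈1 n)

  ^-swap : ∀ x m n → (x ^ m) ^ n ≈ (x ^ n) ^ m
  ^-swap x m n = trans (^-assocʳ x m n) (trans (^-congʳ x (ℕₚ.*-comm m n)) (sym (^-assocʳ x n m)))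

  ^-root : ∀ {x n} → x ^ n ≈ 1# → ∀ j → (x ^ j) ^ n ≈ 1#
  ^-root {x} {n} xⁿ≈1 j = trans (^-swap x j n) (trans (^-congˡ j xⁿ≈1) (1^n≈1 j))

  geometric-fixed : ∀ {u} n → u ^ n ≈ 1# → u * ∑<[ n ] (u ^_) ≈ ∑<[ n ] (u ^_)
  geometric-fixed {u} n uⁿ≈1 = trans (*-distribˡ-sum {n} u ((u ^_) ∘ toℕ)) (∑<-shift n (u ^_) uⁿ≈1)

  u-1∣uⁿ-1 : ∀ u n → u - 1# ∣ u ^ n - 1#
  u-1∣uⁿ-1 u n = s , (begin
    s * (u - 1#)         ≈⟨ x[y-z]≈xy-xz s u 1# ⟩
    s * u - s * 1#       ≈⟨ +-cong (trans (*-comm s u) u*s≈) (-‿cong (*-identityʳ s)) ⟩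
    s + (u ^ n - 1#) - s ≈⟨ xyx⁻¹≈y s (u ^ n - 1#) ⟩
    u ^ n - 1#           ∎)
    where
    s = ∑<[ n ] (u ^_)
    u*s≈ : u * s ≈ s + (u ^ n - 1#)
    u*s≈ = ∙-cancelˡ 1# _ _ (begin
      1# + u * s               ≈⟨ +-congˡ (*-distribˡ-sum {n} u ((u ^_) ∘ toℕ)) ⟩
      1# + ∑<[ n ] ((u ^_) ∘ suc) ≈⟨ ∑<-telescope n (u ^_) ⟩
      s + u ^ n                ≈⟨ +-congˡ (xyx⁻¹≈y 1# (u ^ n)) ⟨
      s + (1# + u ^ n - 1#)    ≈⟨ +-congˡ (+-assoc 1# (u ^ n) (- 1#)) ⟩
      s + (1# + (u ^ n - 1#))  ≈⟨ +-assoc s 1# _ ⟨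
      s + 1# + (u ^ n - 1#)    ≈⟨ +-congʳ (+-comm s 1#) ⟩
      1# + s + (u ^ n - 1#)    ≈⟨ +-assoc 1# s _ ⟩
      1# + (s + (u ^ n - 1#))  ∎)

  record IsLocal : Set (c ⊔ ℓ) where
    field
      0-nonUnit : ¬ Unit 0#
      +-unit    : ∀ x y → Unit (x + y) → Unit x ⊎ Unit y

    sum-unit : ∀ {n} (t : Fin n → Carrier) → Unit (sum t) → ∃ λ i → Unit (t i)
    sum-unit {zero}  t u = contradiction u 0-nonUnit
    sum-unit {suc n} t u with +-unit (t Fin.zero) (sum (t ∘ Fin.suc)) u
    ... | inj₁ u₀ = Fin.zero , u₀
    ... | inj₂ u₊ = let (i , uᵢ) = sum-unit (t ∘ Fin.suc) u₊ in Fin.suc i , uᵢ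

    -- n = ∑ uᵏ + ∑ (1 - uᵏ): the first sum is fixed by u, and u - 1 divides the second.
    root-dichotomy : ∀ {n u} → Unit (n · 1#) → u ^ n ≈ 1# → u ≈ 1# ⊎ Unit (u - 1#)
    root-dichotomy {n} {u} unit uⁿ≈1 with +-unit s r (unit-resp-≈ split unit)
      where
      s r : Carrier
      s = ∑<[ n ] (u ^_)
      r = ∑<[ n ] (λ k → 1# - u ^ k)
      split : n · 1# ≈ s + r
      split = begin
        n · 1#                                  ≈⟨ sum-replicate n ⟨
        ∑<[ n ] (λ _ → 1#)
          ≈⟨ sum-cong-≋ {n} (λ k → trans (sym (+-assoc (u ^ toℕ k) 1# _)) (xyx⁻¹≈y (u ^ toℕ k) 1#)) ⟨
        ∑<[ n ] (λ k → u ^ k + (1# - u ^ k))    ≈⟨ ∑-distrib-+ {n} _ _ ⟩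
        s + r                                   ∎
    ... | inj₁ us = inj₁ (fixed⇒≈1 us (geometric-fixed n uⁿ≈1))
    ... | inj₂ ur = inj₂ (let (k , uk) = sum-unit {n} _ ur in
      ∣ʳ-trans (u-1∣uⁿ-1 u (toℕ k)) (unit-neg (unit-resp-≈ (sym (⁻¹-anti-homo‿- (u ^ toℕ k) 1#)) uk)))
      where
      unit-neg : ∀ {x} → Unit (- x) → Unit x
      unit-neg {x} (q , q-x≈1) = - q , trans (sym (-‿distribˡ-* q x)) (trans (-‿distribʳ-* q x) q-x≈1)

    module Fourier {n : ℕ} {η : Carrier} (n-unit : Unit (n · 1#)) (ηⁿ≈1 : η ^ n ≈ 1#)
      (root-apart : ∀ k → 0 ℕ.< k → k ℕ.< n → Unit (η ^ k - 1#)) where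

      transform : (ℕ → Carrier) → ℕ → Carrier
      transform a j = ∑<[ n ] λ k → (η ^ j) ^ k * a k

      transform-shift : ∀ a → a n ≈ a 0 → ∀ j → η ^ j * transform (a ∘ suc) j ≈ transform a j
      transform-shift a periodic j = begin
        η ^ j * transform (a ∘ suc) j            ≈⟨ *-distribˡ-sum {n} (η ^ j) _ ⟩
        ∑<[ n ] (λ k → η ^ j * ((η ^ j) ^ k * a (suc k)))
          ≈⟨ sum-cong-≋ {n} (λ k → sym (*-assoc (η ^ j) ((η ^ j) ^ toℕ k) (a (suc (toℕ k))))) ⟩
        ∑<[ n ] (λ k → (η ^ j) ^ suc k * a (suc k))
          ≈⟨ ∑<-shift n (λ k → (η ^ j) ^ k * a k) (*-cong (^-root {n = n} ηⁿ≈1 j) periodic) ⟩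
        transform a j                            ∎

      transform-sum : ∀ a → ∑<[ n ] (transform a) ≈ (n · 1#) * a 0
      transform-sum a = begin
        ∑<[ n ] (λ j → ∑<[ n ] λ k → (η ^ j) ^ k * a k)
          ≈⟨ ∑-comm {n} {n} (λ j k → (η ^ toℕ j) ^ toℕ k * a (toℕ k)) ⟩
        ∑<[ n ] (λ k → ∑<[ n ] λ j → (η ^ j) ^ k * a k)
          ≈⟨ sum-cong-≋ {n} (λ k → sym (*-distribʳ-sum {n} (a (toℕ k)) (λ j → (η ^ toℕ j) ^ toℕ k))) ⟩
        ∑<[ n ] (λ k → ∑<[ n ] (λ j → (η ^ j) ^ k) * a k)
          ≈⟨ ∑<-head n-positive (λ k → column k * a k)
               (λ k 0<k k<n → trans (*-congʳ (column-zero k 0<k k<n)) (zeroˡ (a k))) ⟩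
        column 0 * a 0                           ≈⟨ *-congʳ (sum-replicate n) ⟩
        (n · 1#) * a 0                           ∎
        where
        n-positive : 0 ℕ.< n
        n-positive = ℕₚ.n≢0⇒n>0 λ { ≡.refl → 0-nonUnit n-unit }
        column : ℕ → Carrier
        column k = ∑<[ n ] λ j → (η ^ j) ^ k
        column-zero : ∀ k → 0 ℕ.< k → k ℕ.< n → column k ≈ 0#
        column-zero k 0<k k<n = trans (sum-cong-≋ {n} (λ j → ^-swap η (toℕ j) k))
          (fixed⇒≈0 (root-apart k 0<k k<n) (geometric-fixed n (^-root {n = n} ηⁿ≈1 k)))

      transform-unit : ∀ a → Unit (a 0) → ∃ λ (j : Fin n) → Unit (transform a (toℕ j))
      transform-unit a u = sum-unit {n} (transform a ∘ toℕ)
        (unit-resp-≈ (sym (transform-sum a)) (unit-* n-unit u))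

      locate-root : ∀ {z} → z ^ n ≈ 1# → ∃ λ (j : Fin n) → η ^ toℕ j * z ≈ 1#
      locate-root {z} zⁿ≈1 =
        let (j , u) = transform-unit (z ^_) unit-1
        in j , fixed⇒≈1 u (trans (fixed (toℕ j)) (transform-shift (z ^_) zⁿ≈1 (toℕ j)))
        where
        fixed : ∀ j → η ^ j * z * transform (z ^_) j ≈ η ^ j * transform ((z ^_) ∘ suc) j
        fixed j = trans (*-assoc (η ^ j) z _) (*-congˡ (trans (*-distribˡ-sum {n} z _)
          (sum-cong-≋ {n} (λ k → x∙yz≈y∙xz z ((η ^ j) ^ toℕ k) (z ^ toℕ k)))))

module RootsOfUnity where
  open import Data.Integer.Base as ℤ using (+_)
  import Data.Integer.Properties as ℤₚ
  open import Data.Rational.Base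
    using (ℚ; 0ℚ; 1ℚ; ½; ∣_∣; positive; nonNegative; toℚᵘ; *<*; ↥_)
    renaming ( _+_ to _+ℚ_; _*_ to _*ℚ_; -_ to -ℚ_; _-_ to _-ℚ_; _/_ to _/ℚ_
             ; _<_ to _<ℚ_; _≤_ to _≤ℚ_)
  open import Data.Rational.Literals using (fromℤ)
  import Data.Rational.Properties as ℚₚ
  open import Data.Rational.Solver using (module +-*-Solver)
  import Data.Rational.Unnormalised.Base as ℚᵘ
  import Data.Rational.Unnormalised.Properties as ℚᵘₚ
  open import Relation.Binary.PropositionalEquality using (refl; sym; trans; cong; cong₂; subst; subst₂)
  open import Relation.Nullary.Decidable using (from-yes)
  open import Relation.Unary using (Pred; Decidable)

  open +-*-Solver using (solve; _:+_; _:*_; :-_; _:-_; _:=_; con)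

  p≤p+q : ∀ p {q} → 0ℚ ≤ℚ q → p ≤ℚ p +ℚ q
  p≤p+q p {q} q≥0 = subst (_≤ℚ p +ℚ q) (ℚₚ.+-identityʳ p) (ℚₚ.+-monoʳ-≤ p q≥0)

  ≤-by : ∀ {p q} r → 0ℚ ≤ℚ r → p +ℚ r ≡ q → p ≤ℚ q
  ≤-by {p} r r≥0 refl = p≤p+q p r≥0

  0≤-+ : ∀ {p q} → 0ℚ ≤ℚ p → 0ℚ ≤ℚ q → 0ℚ ≤ℚ p +ℚ q
  0≤-+ = ℚₚ.+-mono-≤

  0≤-* : ∀ {p q} → 0ℚ ≤ℚ p → 0ℚ ≤ℚ q → 0ℚ ≤ℚ p *ℚ q
  0≤-* {p} {q} p≥0 q≥0 = ℚₚ.nonNegative⁻¹ _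
    {{ℚₚ.nonNeg*nonNeg⇒nonNeg p {{nonNegative p≥0}} q {{nonNegative q≥0}}}}

  0<-* : ∀ {p q} → 0ℚ <ℚ p → 0ℚ <ℚ q → 0ℚ <ℚ p *ℚ q
  0<-* {p} {q} p>0 q>0 = ℚₚ.positive⁻¹ _ {{ℚₚ.pos*pos⇒pos p {{positive p>0}} q {{positive q>0}}}}

  p≤q⇒0≤q-p : ∀ {p q} → p ≤ℚ q → 0ℚ ≤ℚ q -ℚ p
  p≤q⇒0≤q-p {p} {q} p≤q = subst (_≤ℚ q -ℚ p) (ℚₚ.+-inverseʳ p) (ℚₚ.+-monoˡ-≤ (-ℚ p) p≤q)

  1≤q²⇒1≤q : ∀ {q} → 0ℚ ≤ℚ q → 1ℚ ≤ℚ q *ℚ q → 1ℚ ≤ℚ q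
  1≤q²⇒1≤q {q} q≥0 1≤q² = ℚₚ.≮⇒≥ λ q<1 → ℚₚ.<-irrefl refl (begin-strict
    1ℚ       ≤⟨ 1≤q² ⟩
    q *ℚ q   ≤⟨ ℚₚ.*-monoʳ-≤-nonNeg q {{nonNegative q≥0}} (ℚₚ.<⇒≤ q<1) ⟩
    1ℚ *ℚ q  ≡⟨ ℚₚ.*-identityˡ q ⟩
    q        <⟨ q<1 ⟩
    1ℚ       ∎)
    where open ℚₚ.≤-Reasoning

  fromℤ-suc : ∀ n → fromℤ (+ suc n) ≡ 1ℚ +ℚ fromℤ (+ n)
  fromℤ-suc n = ℚₚ.toℚᵘ-injective (ℚᵘₚ.≃-trans
    (ℚᵘ.*≡* (cong (λ i → i ℤ.* + 1) (sym (cong (λ i → + 1 ℤ.+ i) (ℤₚ.*-identityʳ (+ n))))))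
    (ℚᵘₚ.≃-sym (ℚₚ.toℚᵘ-homo-+ 1ℚ (fromℤ (+ n)))))

  fromℤ-nonNeg : ∀ n → 0ℚ ≤ℚ fromℤ (+ n)
  fromℤ-nonNeg n = ℚₚ.nonNegative⁻¹ (fromℤ (+ n))

  fromℤ-mono : ∀ {m n} → m ℕ.≤ n → fromℤ (+ m) ≤ℚ fromℤ (+ n)
  fromℤ-mono {n = n} ℕ.z≤n = fromℤ-nonNeg n
  fromℤ-mono {suc m} {suc n} (ℕ.s≤s m≤n) = subst₂ _≤ℚ_ (sym (fromℤ-suc m)) (sym (fromℤ-suc n))
    (ℚₚ.+-monoʳ-≤ 1ℚ (fromℤ-mono m≤n))

  archimedean : ∀ p → ∃ λ n → p <ℚ fromℤ (+ n)
  archimedean p@record{} = suc ℤ.∣ ↥ p ∣ , *<* (ℤₚ.<-≤-trans {j = + suc ℤ.∣ ↥ p ∣}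
    (subst (λ i → i ℤ.< + suc ℤ.∣ ↥ p ∣) (sym (ℤₚ.*-identityʳ (↥ p))) (ℤₚ.≤-<-trans (i≤∣i∣ (↥ p)) (ℤ.+<+ (ℕₚ.n<1+n _))))
    (ℤ.+≤+ (ℕₚ.m≤m*n (suc ℤ.∣ ↥ p ∣) _)))
    where
    i≤∣i∣ : ∀ i → i ℤ.≤ + ℤ.∣ i ∣
    i≤∣i∣ (+ n)      = ℤₚ.≤-refl
    i≤∣i∣ (ℤ.-[1+ n ]) = ℤ.-≤+

  halves : ℚ → ℕ → ℚ
  halves w zero    = w
  halves w (suc k) = ½ *ℚ halves w k

  halves-nonNeg : ∀ {w} → 0ℚ ≤ℚ w → ∀ k → 0ℚ ≤ℚ halves w k
  halves-nonNeg w≥0 zero    = w≥0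
  halves-nonNeg w≥0 (suc k) = 0≤-* (ℚₚ.nonNegative⁻¹ ½) (halves-nonNeg w≥0 k)

  halves-bound : ∀ {w} → 0ℚ ≤ℚ w → ∀ k → fromℤ (+ suc k) *ℚ halves w k ≤ℚ w
  halves-bound {w} w≥0 zero = ℚₚ.≤-reflexive (ℚₚ.*-identityˡ w)
  halves-bound {w} w≥0 (suc k) = begin
    fromℤ (+ suc (suc k)) *ℚ (½ *ℚ h)
      ≡⟨ cong (_*ℚ (½ *ℚ h)) (trans (fromℤ-suc (suc k)) (cong (1ℚ +ℚ_) (fromℤ-suc k))) ⟩
    (1ℚ +ℚ (1ℚ +ℚ x)) *ℚ (½ *ℚ h)
      ≤⟨ ≤-by (x *ℚ (½ *ℚ h)) (0≤-* (fromℤ-nonNeg k) (halves-nonNeg w≥0 (suc k)))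
           (solve 2 (λ x h → (con 1ℚ :+ (con 1ℚ :+ x)) :* (con ½ :* h) :+ x :* (con ½ :* h)
                               := (con 1ℚ :+ x) :* h) refl x h) ⟩
    (1ℚ +ℚ x) *ℚ h              ≡⟨ cong (_*ℚ h) (fromℤ-suc k) ⟨
    fromℤ (+ suc k) *ℚ h        ≤⟨ halves-bound w≥0 k ⟩
    w                           ∎
    where
    open ℚₚ.≤-Reasoning
    x = fromℤ (+ k)
    h = halves w k

  halves-small : ∀ {w} → 0ℚ ≤ℚ w → ∀ ε → 0ℚ <ℚ ε → Eventually (λ k → halves w k <ℚ ε)
  halves-small {w} w≥0 ε ε>0 with archimedean (recip⁺ ε (positive ε>0) *ℚ w)
  ... | K , p = K , λ k K≤k →
    ℚₚ.*-cancelˡ-<-nonNeg (fromℤ (+ suc k)) {{nonNegative (fromℤ-nonNeg (suc k))}} (begin-strict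
      fromℤ (+ suc k) *ℚ halves w k    ≤⟨ halves-bound w≥0 k ⟩
      w                                ≡⟨ ℚₚ.*-identityʳ w ⟨
      w *ℚ 1ℚ                          ≡⟨ cong (w *ℚ_) (recip⁺-inverseˡ ε (positive ε>0)) ⟨
      w *ℚ (r *ℚ ε)                    ≡⟨ solve 3 (λ w r e → w :* (r :* e) := (r :* w) :* e) refl w r ε ⟩
      (r *ℚ w) *ℚ ε                    <⟨ ℚₚ.*-monoˡ-<-pos ε {{positive ε>0}} p ⟩
      fromℤ (+ K) *ℚ ε                 ≤⟨ ℚₚ.*-monoʳ-≤-nonNeg ε {{nonNegative (ℚₚ.<⇒≤ ε>0)}}
                                            (fromℤ-mono (ℕₚ.m≤n⇒m≤1+n K≤k)) ⟩
      fromℤ (+ suc k) *ℚ ε             ∎)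
    where
    open ℚₚ.≤-Reasoning
    r = recip⁺ ε (positive ε>0)

  ∣p-q∣<-by : ∀ {p q r} → p <ℚ q +ℚ r → q <ℚ p +ℚ r → ∣ p -ℚ q ∣ <ℚ r
  ∣p-q∣<-by {p} {q} {r} p<q+r q<p+r with ℚₚ.∣p∣≡p∨∣p∣≡-p (p -ℚ q)
  ... | inj₁ eq = subst₂ _<ℚ_ (sym eq)
    (solve 2 (λ q r → (q :+ r) :+ (:- q) := r) refl q r) (ℚₚ.+-monoˡ-< (-ℚ q) p<q+r)
  ... | inj₂ eq = subst₂ _<ℚ_ (trans (solve 2 (λ p q → q :+ (:- p) := :- (p :- q)) refl p q) (sym eq))
    (solve 2 (λ p r → (p :+ r) :+ (:- p) := r) refl p r) (ℚₚ.+-monoˡ-< (-ℚ p) q<p+r)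

  ∣p-q∣<⇒p<q+r : ∀ {p q r} → ∣ p -ℚ q ∣ <ℚ r → p <ℚ q +ℚ r
  ∣p-q∣<⇒p<q+r {p} {q} {r} d = subst (_<ℚ q +ℚ r)
    (solve 2 (λ p q → q :+ (p :- q) := p) refl p q)
    (ℚₚ.+-monoʳ-< q (ℚₚ.≤-<-trans (p≤∣p∣ (p -ℚ q)) d))

  ∣p-q∣<⇒q<p+r : ∀ {p q r} → ∣ p -ℚ q ∣ <ℚ r → q <ℚ p +ℚ r
  ∣p-q∣<⇒q<p+r {p} {q} d = ∣p-q∣<⇒p<q+r (close-sym p q d)

  module _ {ℓ} {Q : Pred ℚ ℓ} (Q? : Decidable Q) where

    private
      record Bracket (w : ℚ) : Set ℓ where
        field
          lo hi : ℚ
          ¬Q-lo : ¬ Q lo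
          Q-hi  : Q hi
          width : lo +ℚ w ≡ hi

      open Bracket

      bisect : ∀ {w} → 0ℚ ≤ℚ w → (b : Bracket w) →
               ∃ λ (b′ : Bracket (½ *ℚ w)) → lo b ≤ℚ lo b′ × hi b′ ≤ℚ hi b
      bisect {w} w≥0 b with Q? (lo b +ℚ ½ *ℚ w)
      ... | yes q = record { lo = lo b ; hi = lo b +ℚ ½ *ℚ w ; ¬Q-lo = ¬Q-lo b ; Q-hi = q ; width = refl }
        , ℚₚ.≤-refl , ≤-by (½ *ℚ w) (0≤-* (ℚₚ.nonNegative⁻¹ ½) w≥0)
            (trans (trans (ℚₚ.+-assoc (lo b) _ _) (cong (lo b +ℚ_) (half+half w))) (width b))
      ... | no ¬q = record { lo = lo b +ℚ ½ *ℚ w ; hi = hi b ; ¬Q-lo = ¬q ; Q-hi = Q-hi b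
                           ; width = trans (trans (ℚₚ.+-assoc (lo b) _ _) (cong (lo b +ℚ_) (half+half w))) (width b) }
        , p≤p+q (lo b) (0≤-* (ℚₚ.nonNegative⁻¹ ½) w≥0) , ℚₚ.≤-refl

    bisection : ∀ {p q} → p ≤ℚ q → ¬ Q p → Q q →
                ∃₂ λ x y → x ≃ y × (∀ n → ¬ Q (seq x n)) × (∀ n → Q (seq y n))
    bisection {p} {q} p≤q ¬Qp Qq = x , y , x≃y , (λ n → ¬Q-lo (b n)) , (λ n → Q-hi (b n))
      where
      w = q -ℚ p
      w≥0 = p≤q⇒0≤q-p p≤q
      b : ∀ n → Bracket (halves w n)
      b zero    = record { lo = p ; hi = q ; ¬Q-lo = ¬Qp ; Q-hi = Qq
                         ; width = solve 2 (λ p q → p :+ (q :- p) := q) refl p q }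
      b (suc n) = proj₁ (bisect (halves-nonNeg w≥0 n) (b n))
      lo≤hi : ∀ n → lo (b n) ≤ℚ hi (b n)
      lo≤hi n = ≤-by (halves w n) (halves-nonNeg w≥0 n) (width (b n))
      nested : ∀ {m n} → m ℕ.≤′ n → lo (b m) ≤ℚ lo (b n) × hi (b n) ≤ℚ hi (b m)
      nested (ℕ.≤′-reflexive refl) = ℚₚ.≤-refl , ℚₚ.≤-refl
      nested {n = suc n} (ℕ.≤′-step m≤n) =
        let (l , h)   = nested m≤n
            (l′ , h′) = proj₂ (bisect (halves-nonNeg w≥0 n) (b n))
        in ℚₚ.≤-trans l l′ , ℚₚ.≤-trans h′ h
      within : ∀ K u v ε → halves w K <ℚ ε → lo (b K) ≤ℚ u → u ≤ℚ hi (b K) →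
               lo (b K) ≤ℚ v → v ≤ℚ hi (b K) → ∣ u -ℚ v ∣ <ℚ ε
      within K u v ε small lu uh lv vh = ∣p-q∣<-by {u} {v} {ε} (bound u v uh lv) (bound v u vh lu)
        where
        bound : ∀ s t → s ≤ℚ hi (b K) → lo (b K) ≤ℚ t → s <ℚ t +ℚ ε
        bound s t s≤hi lo≤t = begin-strict
          s                        ≤⟨ s≤hi ⟩
          hi (b K)                 ≡⟨ width (b K) ⟨
          lo (b K) +ℚ halves w K   <⟨ ℚₚ.+-mono-≤-< lo≤t small ⟩
          t +ℚ ε                   ∎
          where open ℚₚ.≤-Reasoning
      limit : (s : ℕ → ℚ) → (∀ n → lo (b n) ≤ℚ s n) → (∀ n → s n ≤ℚ hi (b n)) → ℝ
      limit s l h .seq = s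
      limit s l h .cauchy ε ε>0 =
        let (K , small) = halves-small w≥0 ε ε>0
        in K , λ m n K≤m K≤n →
          let (lm , hm) = nested (ℕₚ.≤⇒≤′ K≤m)
              (ln , hn) = nested (ℕₚ.≤⇒≤′ K≤n)
          in within K (s m) (s n) ε (small K ℕₚ.≤-refl)
               (ℚₚ.≤-trans lm (l m)) (ℚₚ.≤-trans (h m) hm)
               (ℚₚ.≤-trans ln (l n)) (ℚₚ.≤-trans (h n) hn)
      x y : ℝ
      x = limit (λ n → lo (b n)) (λ n → ℚₚ.≤-refl) lo≤hi
      y = limit (λ n → hi (b n)) lo≤hi (λ n → ℚₚ.≤-refl)
      x≃y : x ≃ y
      x≃y .close ε ε>0 = mapᵉ (λ n small → within n (lo (b n)) (hi (b n)) ε small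
        ℚₚ.≤-refl (lo≤hi n) (lo≤hi n) ℚₚ.≤-refl) (halves-small w≥0 ε ε>0)

  open Units ℂ-commutativeRing public
  open import Algebra.Properties.CommutativeSemiring.Exp ℂR.commutativeSemiring public
    using (_^_; ^-congˡ; ^-distrib-*)

  sum≃1⇒positive : ∀ x y → x +ᴿ y ≃ 1ℝ → 0ℝ < x ⊎ 0ℝ < y
  sum≃1⇒positive x y x+y≃1 = split (seq x N ℚₚ.≤? ½)
    where
    open ℚₚ.≤-Reasoning
    ⅛ ¼ : ℚ
    ⅛ = + 1 /ℚ 8
    ¼ = + 1 /ℚ 4
    N : ℕ
    N = proj₁ (cauchy x ⅛ (ℚₚ.positive⁻¹ ⅛))
    near : Eventually (λ n → ∣ seq x n -ℚ seq x N ∣ <ℚ ⅛)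
    near = N , λ n N≤n → proj₂ (cauchy x ⅛ (ℚₚ.positive⁻¹ ⅛)) n N N≤n ℕₚ.≤-refl
    0<¼ = ℚₚ.positive⁻¹ ¼
    x-bound : ½ <ℚ seq x N → ∀ n → ∣ seq x n -ℚ seq x N ∣ <ℚ ⅛ → 0ℚ +ℚ ¼ ≤ℚ seq x n
    x-bound ½<xN n xn≈xN = ℚₚ.≮⇒≥ λ xn<¼ → ℚₚ.<-irrefl refl (begin-strict
      ½                <⟨ ½<xN ⟩
      seq x N          <⟨ ∣p-q∣<⇒q<p+r {seq x n} {seq x N} {⅛} xn≈xN ⟩
      seq x n +ℚ ⅛     <⟨ ℚₚ.+-monoˡ-< ⅛ xn<¼ ⟩
      ¼ +ℚ ⅛           <⟨ from-yes (¼ +ℚ ⅛ ℚₚ.<? ½) ⟩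
      ½                ∎)
    y-bound : seq x N ≤ℚ ½ → ∀ n → ∣ seq x n -ℚ seq x N ∣ <ℚ ⅛ →
              ∣ (seq x n +ℚ seq y n) -ℚ 1ℚ ∣ <ℚ ⅛ → 0ℚ +ℚ ¼ ≤ℚ seq y n
    y-bound xN≤½ n xn≈xN sum≈1 = ℚₚ.≮⇒≥ λ yn<¼ → ℚₚ.<-irrefl refl (begin-strict
      1ℚ                               <⟨ ∣p-q∣<⇒q<p+r {seq x n +ℚ seq y n} {1ℚ} {⅛} sum≈1 ⟩
      (seq x n +ℚ seq y n) +ℚ ⅛        <⟨ ℚₚ.+-monoˡ-< ⅛ (ℚₚ.+-mono-< (∣p-q∣<⇒p<q+r {seq x n} {seq x N} {⅛} xn≈xN) yn<¼) ⟩
      ((seq x N +ℚ ⅛) +ℚ ¼) +ℚ ⅛       ≤⟨ ℚₚ.+-monoˡ-≤ ⅛ (ℚₚ.+-monoˡ-≤ ¼ (ℚₚ.+-monoˡ-≤ ⅛ xN≤½)) ⟩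
      ((½ +ℚ ⅛) +ℚ ¼) +ℚ ⅛             ≡⟨⟩
      1ℚ                               ∎)
    split : Dec (seq x N ≤ℚ ½) → 0ℝ < x ⊎ 0ℝ < y
    split (no xN≰½)  = inj₁ (mk< ¼ 0<¼ (mapᵉ (x-bound (ℚₚ.≰⇒> xN≰½)) near))
    split (yes xN≤½) = inj₂ (mk< ¼ 0<¼ (mapᵉ (λ n (p , q) → y-bound xN≤½ n p q)
      (near ∩ᵉ close x+y≃1 ⅛ (ℚₚ.positive⁻¹ ⅛))))

  positive-re⇒unit : ∀ z → 0ℝ < re z → Unit z
  positive-re⇒unit z p = inv z (positive-re⇒≉0 z p) , inv-inverseˡ z (positive-re⇒≉0 z p)

  ℂ-isLocal : IsLocal
  ℂ-isLocal = record
    { 0-nonUnit = λ (q , q*0≈1) → 0≉1 (ℂR.trans (ℂR.sym (ℂR.zeroʳ q)) q*0≈1)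
    ; +-unit = λ z w (q , q[z+w]≈1) →
        [ (λ p → inj₁ (unit-factorʳ (positive-re⇒unit (q *ᶜ z) p)))
        , (λ p → inj₂ (unit-factorʳ (positive-re⇒unit (q *ᶜ w) p))) ]′
        (sum≃1⇒positive (re (q *ᶜ z)) (re (q *ᶜ w))
          (re≃ (ℂR.trans (ℂR.sym (ℂR.distribˡ q z w)) q[z+w]≈1)))
    }
    where
    0≉1 : ¬ (0ᶜ ≈ᶜ 1ᶜ)
    0≉1 (mk≈ 0≃1 _) =
      let (N , p) = close 0≃1 ½ (ℚₚ.positive⁻¹ ½)
      in ℚₚ.<-asym (p N ℕₚ.≤-refl) (from-yes (½ ℚₚ.<? 1ℚ))

  fromℕ≈ : ∀ n → fromℕ n ≈ᶜ fromℝ (constant (fromℤ (+ n)))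
  fromℕ≈ zero    = ℂR.refl
  fromℕ≈ (suc n) = ℂR.trans (ℂR.+-congˡ {1ᶜ} (fromℕ≈ n))
    (pointwiseᶜ (λ _ → sym (fromℤ-suc n)) (λ _ → ℚₚ.+-identityˡ _))

  1/n*n≈1 : ∀ n .{{_ : ℕ.NonZero n}} → fromℝ (constant (+ 1 /ℚ n)) *ᶜ fromℕ n ≈ᶜ 1ᶜ
  1/n*n≈1 (suc m) = ℂR.trans (ℂR.*-congˡ (fromℕ≈ (suc m))) (pointwiseᶜ
    (λ _ → trans (solve 2 (λ a b → a :* b :+ :- (con 0ℚ :* con 0ℚ) := a :* b) refl 1/n n) 1/n*n≡1)
    (λ _ → solve 2 (λ a b → a :* con 0ℚ :+ con 0ℚ :* b := con 0ℚ) refl 1/n n))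
    where
    1/n n : ℚ
    1/n = + 1 /ℚ suc m
    n = fromℤ (+ suc m)
    1/n*n≡1 : 1/n *ℚ n ≡ 1ℚ
    1/n*n≡1 = ℚₚ.toℚᵘ-injective (ℚᵘₚ.≃-trans (ℚₚ.toℚᵘ-homo-* 1/n n)
      (ℚᵘₚ.≃-trans (ℚᵘₚ.*-congʳ {toℚᵘ n} (ℚₚ.toℚᵘ-fromℚᵘ (ℚᵘ.mkℚᵘ (+ 1) m)))
        (ℚᵘ.*≡* (cong (λ k → + suc k)
          (trans (cong (ℕ._* 1) (ℕₚ.+-identityʳ m)) (sym (ℕₚ.+-identityʳ (m ℕ.* 1))))))))

  -- re^ c d and im^ c d are the real and imaginary parts of (c + i)ᵈ.
  re^ im^ : ℚ → ℕ → ℚ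
  re^ c zero    = 1ℚ
  re^ c (suc d) = c *ℚ re^ c d +ℚ -ℚ (1ℚ *ℚ im^ c d)
  im^ c zero    = 0ℚ
  im^ c (suc d) = c *ℚ im^ c d +ℚ 1ℚ *ℚ re^ c d

  _+i : ℝ → ℂ
  (x +i) .re = x
  (x +i) .im = 1ℝ

  seq-re^ : ∀ x d n → seq (re ((x +i) ^ d)) n ≡ re^ (seq x n) d
  seq-im^ : ∀ x d n → seq (im ((x +i) ^ d)) n ≡ im^ (seq x n) d
  seq-re^ x zero    n = refl
  seq-re^ x (suc d) n = cong₂ (λ r s → seq x n *ℚ r +ℚ -ℚ (1ℚ *ℚ s)) (seq-re^ x d n) (seq-im^ x d n)
  seq-im^ x zero    n = refl
  seq-im^ x (suc d) n = cong₂ (λ s r → seq x n *ℚ s +ℚ 1ℚ *ℚ r) (seq-im^ x d n) (seq-re^ x d n)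

  norm^≥1 : ∀ c d → 1ℚ ≤ℚ re^ c d *ℚ re^ c d +ℚ im^ c d *ℚ im^ c d
  norm^≥1 c zero    = ℚₚ.≤-refl
  norm^≥1 c (suc d) = ℚₚ.≤-trans (norm^≥1 c d)
    (≤-by (c *ℚ c *ℚ (r *ℚ r +ℚ s *ℚ s)) (0≤-* (square≥0 c) (0≤-+ (square≥0 r) (square≥0 s)))
      (solve 3 (λ c r s → (r :* r :+ s :* s) :+ c :* c :* (r :* r :+ s :* s)
        := (c :* r :+ :- (con 1ℚ :* s)) :* (c :* r :+ :- (con 1ℚ :* s))
           :+ (c :* s :+ con 1ℚ :* r) :* (c :* s :+ con 1ℚ :* r)) refl c r s))
    where
    r = re^ c d
    s = im^ c d

  -- Turán's identity  im₁² = im₂ im₀ + |(c + i)ᵈ|²  for consecutive imaginary parts.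
  im^≥1 : ∀ c d → 0ℚ ≤ℚ im^ c d → 0ℚ ≤ℚ im^ c (suc d) → 0ℚ ≤ℚ im^ c (suc (suc d)) → 1ℚ ≤ℚ im^ c (suc d)
  im^≥1 c d s≥0 s₁≥0 s₂≥0 = 1≤q²⇒1≤q s₁≥0 (ℚₚ.≤-trans (norm^≥1 c d)
    (≤-by (im^ c (suc (suc d)) *ℚ s) (0≤-* s₂≥0 s≥0)
      (solve 3 (λ c r s → (r :* r :+ s :* s)
           :+ (c :* (c :* s :+ con 1ℚ :* r) :+ con 1ℚ :* (c :* r :+ :- (con 1ℚ :* s))) :* s
        := (c :* s :+ con 1ℚ :* r) :* (c :* s :+ con 1ℚ :* r)) refl c r s)))
    where
    r = re^ c d
    s = im^ c d

  -- Writing c = cot θ, this says that dθ < π for 1 ≤ d ≤ N.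
  UpperHalf : ℕ → ℚ → Set
  UpperHalf N c = ∀ {d} → d ℕ.< N → 0ℚ <ℚ im^ c (suc d)

  upperHalf? : ∀ N → Decidable (UpperHalf N)
  upperHalf? N c = ℕₚ.allUpTo? (λ d → 0ℚ ℚₚ.<? im^ c (suc d)) N

  ¬upperHalf-0 : ∀ N → ¬ UpperHalf (suc (suc N)) 0ℚ
  ¬upperHalf-0 N h = ℚₚ.<-irrefl refl (h {1} (ℕ.s≤s (ℕ.s≤s ℕ.z≤n)))

  fromℤ-+ : ∀ m n → fromℤ (+ (m ℕ.+ n)) ≡ fromℤ (+ m) +ℚ fromℤ (+ n)
  fromℤ-+ zero    n = sym (ℚₚ.+-identityˡ (fromℤ (+ n)))
  fromℤ-+ (suc m) n = trans (fromℤ-suc (m ℕ.+ n)) (trans (cong (1ℚ +ℚ_) (fromℤ-+ m n))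
    (trans (sym (ℚₚ.+-assoc 1ℚ (fromℤ (+ m)) (fromℤ (+ n)))) (cong (_+ℚ fromℤ (+ n)) (sym (fromℤ-suc m)))))

  -- With N = d + k, the bound k · im ≤ d · re for (N + i)ᵈ is the estimate
  -- cot(dθ) ≥ cot θ / d - 1 for cot θ = N, valid while d ≤ N.
  cot-bound-step : ∀ {c r s e k} → c ≡ e +ℚ (1ℚ +ℚ k) → 0ℚ <ℚ e → 0ℚ ≤ℚ k → 0ℚ <ℚ s →
    (1ℚ +ℚ k) *ℚ s ≤ℚ e *ℚ r →
    0ℚ <ℚ c *ℚ s +ℚ 1ℚ *ℚ r ×
    k *ℚ (c *ℚ s +ℚ 1ℚ *ℚ r) ≤ℚ (1ℚ +ℚ e) *ℚ (c *ℚ r +ℚ -ℚ (1ℚ *ℚ s))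
  cot-bound-step {c} {r} {s} {e} {k} refl e>0 k≥0 s>0 bound = positive-im ,
    ℚₚ.*-cancelˡ-≤-pos e {{positive e>0}} (≤-by
      ((e *ℚ r -ℚ (1ℚ +ℚ k) *ℚ s) *ℚ (e *ℚ e +ℚ e *ℚ (1ℚ +ℚ k) +ℚ e +ℚ 1ℚ)
        +ℚ s *ℚ (e +ℚ e *ℚ k +ℚ e *ℚ k +ℚ (1ℚ +ℚ k)))
      (0≤-+ (0≤-* (p≤q⇒0≤q-p bound) (0≤-+ (0≤-+ (0≤-+ (0≤-* e≥0 e≥0) (0≤-* e≥0 m≥0)) e≥0) 0≤1))
            (0≤-* (ℚₚ.<⇒≤ s>0) (0≤-+ (0≤-+ (0≤-+ e≥0 (0≤-* e≥0 k≥0)) (0≤-* e≥0 k≥0)) m≥0)))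
      (solve 4 (λ r s e k →
          e :* (k :* ((e :+ (con 1ℚ :+ k)) :* s :+ con 1ℚ :* r)) :+
          ((e :* r :- (con 1ℚ :+ k) :* s) :* (e :* e :+ e :* (con 1ℚ :+ k) :+ e :+ con 1ℚ)
            :+ s :* (e :+ e :* k :+ e :* k :+ (con 1ℚ :+ k)))
        := e :* ((con 1ℚ :+ e) :* ((e :+ (con 1ℚ :+ k)) :* r :+ :- (con 1ℚ :* s)))) refl r s e k))
    where
    0≤1 = ℚₚ.nonNegative⁻¹ 1ℚ
    e≥0 = ℚₚ.<⇒≤ e>0
    m≥0 : 0ℚ ≤ℚ 1ℚ +ℚ k
    m≥0 = 0≤-+ 0≤1 k≥0
    r≥0 : 0ℚ ≤ℚ r
    r≥0 = ℚₚ.*-cancelˡ-≤-pos e {{positive e>0}}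
      (ℚₚ.≤-trans (ℚₚ.≤-reflexive (ℚₚ.*-zeroʳ e)) (ℚₚ.≤-trans (0≤-* m≥0 (ℚₚ.<⇒≤ s>0)) bound))
    positive-im : 0ℚ <ℚ c *ℚ s +ℚ 1ℚ *ℚ r
    positive-im = ℚₚ.+-mono-<-≤
      (0<-* (ℚₚ.+-mono-<-≤ e>0 m≥0) s>0) (0≤-* 0≤1 r≥0)

  upperHalf-N : ∀ N → UpperHalf N (fromℤ (+ N))
  upperHalf-N N {d} d<N = proj₁ (bound d (N ℕ.∸ suc d) (ℕₚ.m+[n∸m]≡n d<N))
    where
    c = fromℤ (+ N)
    bound : ∀ d k → suc d ℕ.+ k ≡ N →
            0ℚ <ℚ im^ c (suc d) × fromℤ (+ k) *ℚ im^ c (suc d) ≤ℚ fromℤ (+ suc d) *ℚ re^ c (suc d)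
    bound zero k refl = subst₂ (λ s r → 0ℚ <ℚ s × fromℤ (+ k) *ℚ s ≤ℚ fromℤ (+ 1) *ℚ r)
      (solve 1 (λ c → con 1ℚ := c :* con 0ℚ :+ con 1ℚ :* con 1ℚ) refl c)
      (solve 1 (λ c → c := c :* con 1ℚ :+ :- (con 1ℚ :* con 0ℚ)) refl c)
      (ℚₚ.positive⁻¹ 1ℚ , (begin
        fromℤ (+ k) *ℚ 1ℚ      ≡⟨ ℚₚ.*-identityʳ _ ⟩
        fromℤ (+ k)            ≤⟨ fromℤ-mono (ℕₚ.n≤1+n k) ⟩
        c                      ≡⟨ ℚₚ.*-identityˡ c ⟨
        fromℤ (+ 1) *ℚ c       ∎))
      where open ℚₚ.≤-Reasoning
    bound (suc d) k eq =
      let (s>0 , ks≤er) = bound d (suc k) (trans (ℕₚ.+-suc (suc d) k) eq)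
          (s′>0 , bound′) = cot-bound-step {c} {re^ c (suc d)} {im^ c (suc d)} {fromℤ (+ suc d)} {fromℤ (+ k)}
            (trans (cong (λ n → fromℤ (+ n)) (sym (trans (ℕₚ.+-suc (suc d) k) eq)))
              (trans (fromℤ-+ (suc d) (suc k)) (cong (fromℤ (+ suc d) +ℚ_) (fromℤ-suc k))))
            (ℚₚ.positive⁻¹ (fromℤ (+ suc d))) (fromℤ-nonNeg k) s>0
            (subst (λ m → m *ℚ im^ c (suc d) ≤ℚ fromℤ (+ suc d) *ℚ re^ c (suc d)) (fromℤ-suc k) ks≤er)
      in s′>0 , subst (λ m → fromℤ (+ k) *ℚ im^ c (suc (suc d)) ≤ℚ m *ℚ re^ c (suc (suc d)))
                  (sym (fromℤ-suc (suc d))) bound′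

  eventually-all : ∀ n {Q : ℕ → ℕ → Set} → (∀ d → Eventually (Q d)) → Eventually (λ k → ∀ {d} → d ℕ.< n → Q d k)
  eventually-all zero    ev = 0 , λ _ _ ()
  eventually-all (suc n) {Q} ev = mapᵉ extend (eventually-all n ev ∩ᵉ ev n)
    where
    extend : ∀ k → (∀ {d} → d ℕ.< n → Q d k) × Q n k → ∀ {d} → d ℕ.< suc n → Q d k
    extend k (below , at) {d} (ℕ.s≤s d≤n) with ℕₚ.m≤n⇒m<n∨m≡n d≤n
    ... | inj₁ d<n  = below d<n
    ... | inj₂ refl = at

  -- At a boundary point of UpperHalf n the imaginary parts of the powers 1, …, n - 1 are still at
  -- least 1, so it is the n-th one that changes sign there.
  module _ (N : ℕ) where
    private
      n = suc (suc N)

      brackets : ∃₂ λ x y → x ≃ y × (∀ k → ¬ UpperHalf n (seq x k)) × (∀ k → UpperHalf n (seq y k))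
      brackets = bisection (upperHalf? n) (fromℤ-nonNeg n) (¬upperHalf-0 N) (upperHalf-N n)

    critical-cot : ∃ λ t → im ((t +i) ^ n) ≃ 0ℝ × (∀ d → suc d ℕ.< n → ∀ k → 1ℚ ≤ℚ seq (im ((t +i) ^ suc d)) k)
    critical-cot =
      let (x , y , x≃y , below , above) = brackets
          powers : ∀ d → (x +i) ^ d ≈ᶜ (y +i) ^ d
          powers d = ^-congˡ d (mk≈ x≃y ≃-refl)
          im-close : ∀ d ε → 0ℚ <ℚ ε → Eventually (λ k → ∣ im^ (seq x k) d -ℚ im^ (seq y k) d ∣ <ℚ ε)
          im-close d ε ε>0 = mapᵉ (λ k → subst₂ (λ a b → ∣ a -ℚ b ∣ <ℚ ε) (seq-im^ x d k) (seq-im^ y d k))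
                                  (close (im≃ (powers d)) ε ε>0)
      in y
       , record { close = λ ε ε>0 → mapᵉ
            (λ k (small , near) → subst (λ s → ∣ s -ℚ 0ℚ ∣ <ℚ ε) (sym (seq-im^ y n k))
              (vanishing (seq x k) (seq y k) ε ε>0 (below k) (above k) small near))
            (im-close n ε ε>0 ∩ᵉ eventually-all (suc N) (λ d → im-close (suc d) 1ℚ (ℚₚ.positive⁻¹ 1ℚ))) }
       , λ d d<n k → subst (1ℚ ≤ℚ_) (sym (seq-im^ y (suc d) k)) (lower (seq y k) (above k) d d<n)
      where
      nonNegative-im : ∀ c → UpperHalf n c → ∀ d → d ℕ.≤ n → 0ℚ ≤ℚ im^ c d
      nonNegative-im c h zero    _   = ℚₚ.≤-refl
      nonNegative-im c h (suc d) d<n = ℚₚ.<⇒≤ (h d<n)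
      lower : ∀ c → UpperHalf n c → ∀ d → suc d ℕ.< n → 1ℚ ≤ℚ im^ c (suc d)
      lower c h d d+1<n = im^≥1 c d (nonNegative-im c h d (ℕₚ.≤-trans (ℕₚ.n≤1+n d) (ℕₚ.<⇒≤ d+1<n)))
        (nonNegative-im c h (suc d) (ℕₚ.<⇒≤ d+1<n)) (nonNegative-im c h (suc (suc d)) d+1<n)
      vanishing : ∀ a b ε → 0ℚ <ℚ ε → ¬ UpperHalf n a → UpperHalf n b →
                  ∣ im^ a n -ℚ im^ b n ∣ <ℚ ε →
                  (∀ {d} → d ℕ.< suc N → ∣ im^ a (suc d) -ℚ im^ b (suc d) ∣ <ℚ 1ℚ) →
                  ∣ im^ b n -ℚ 0ℚ ∣ <ℚ ε
      vanishing a b ε ε>0 ¬a hb small near = ∣p-q∣<-by {im^ b n} {0ℚ} {ε}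
        (ℚₚ.<-≤-trans (∣p-q∣<⇒q<p+r {im^ a n} {im^ b n} {ε} small) (ℚₚ.+-monoˡ-≤ ε a-nonPos))
        (ℚₚ.+-mono-< (hb ℕₚ.≤-refl) ε>0)
        where
        a-positive : ∀ {d} → d ℕ.< suc N → 0ℚ <ℚ im^ a (suc d)
        a-positive {d} d<N+1 = ℚₚ.≰⇒> λ a≤0 → ℚₚ.<-irrefl refl (begin-strict
          1ℚ                     ≤⟨ lower b hb d (ℕ.s≤s d<N+1) ⟩
          im^ b (suc d)          <⟨ ∣p-q∣<⇒q<p+r {im^ a (suc d)} {im^ b (suc d)} {1ℚ} (near d<N+1) ⟩
          im^ a (suc d) +ℚ 1ℚ    ≤⟨ ℚₚ.+-monoˡ-≤ 1ℚ a≤0 ⟩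
          0ℚ +ℚ 1ℚ               ≡⟨⟩
          1ℚ                     ∎)
          where open ℚₚ.≤-Reasoning
        a-nonPos : im^ a n ≤ℚ 0ℚ
        a-nonPos = ℚₚ.≮⇒≥ λ 0<aₙ → ¬a λ {d} d<n → all-positive 0<aₙ d (ℕₚ.m≤n⇒m<n∨m≡n d<n)
          where
          all-positive : 0ℚ <ℚ im^ a n → ∀ d → suc d ℕ.< n ⊎ suc d ≡ n → 0ℚ <ℚ im^ a (suc d)
          all-positive 0<aₙ d (inj₁ d+1<n) = a-positive (ℕ.s<s⁻¹ d+1<n)
          all-positive 0<aₙ d (inj₂ refl)  = 0<aₙ

  open import Relation.Binary.Reasoning.Setoid ℂR.setoid

  conj-homo-* : ∀ z w → conj (z *ᶜ w) ≈ᶜ conj z *ᶜ conj w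
  conj-homo-* z w = pointwiseᶜ
    (λ n → solve 4 (λ a b c d → a :* c :+ :- (b :* d) := a :* c :+ :- ((:- b) :* (:- d))) refl
      (seq (re z) n) (seq (im z) n) (seq (re w) n) (seq (im w) n))
    (λ n → solve 4 (λ a b c d → :- (a :* d :+ b :* c) := a :* (:- d) :+ (:- b) :* c) refl
      (seq (re z) n) (seq (im z) n) (seq (re w) n) (seq (im w) n))

  conj-homo-^ : ∀ z d → conj (z ^ d) ≈ᶜ conj z ^ d
  conj-homo-^ z zero    = pointwiseᶜ (λ _ → refl) (λ _ → refl)
  conj-homo-^ z (suc d) = ℂR.trans (conj-homo-* z (z ^ d)) (ℂR.*-congˡ (conj-homo-^ z d))

  real⇒conj : ∀ {z} → im z ≃ 0ℝ → conj z ≈ᶜ z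
  real⇒conj {z} im≃0 = mk≈ ≃-refl (≃-trans (-ᴿ-cong im≃0) (≃-trans (pointwise λ _ → refl) (≃-sym im≃0)))

  -- Multiplication by -i turns z - conj z = 2i Im z into 2 Im z.
  im≥1⇒unit : ∀ z → (∀ n → 1ℚ ≤ℚ seq (im z) n) → Unit (z -ᶜ conj z)
  im≥1⇒unit z im≥1 = unit-factorʳ (positive-re⇒unit (-i *ᶜ (z -ᶜ conj z)) (mk< 1ℚ (ℚₚ.positive⁻¹ 1ℚ)
    (0 , λ n _ → bound (seq (re z) n) (seq (im z) n) (im≥1 n))))
    where
    -i : ℂ
    -i .re = 0ℝ
    -i .im = constant (-ℚ 1ℚ)
    bound : ∀ a b → 1ℚ ≤ℚ b → 0ℚ +ℚ 1ℚ ≤ℚ 0ℚ *ℚ (a -ℚ a) +ℚ -ℚ ((-ℚ 1ℚ) *ℚ (b -ℚ (-ℚ b)))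
    bound a b b≥1 = ≤-by (b +ℚ (b -ℚ 1ℚ))
      (0≤-+ (ℚₚ.≤-trans (ℚₚ.nonNegative⁻¹ 1ℚ) b≥1) (p≤q⇒0≤q-p b≥1))
      (solve 2 (λ a b → (con 0ℚ :+ con 1ℚ) :+ (b :+ (b :- con 1ℚ))
         := con 0ℚ :* (a :- a) :+ :- ((:- con 1ℚ) :* (b :- (:- b)))) refl a b)

  record PrimitiveRoot (n : ℕ) : Set where
    field
      root       : Circle
      root^n     : val root ^ n ≈ᶜ 1ᶜ
      root-apart : ∀ k → 0 ℕ.< k → k ℕ.< n → Unit (val root ^ k -ᶜ 1ᶜ)

  cot⇒primitiveRoot : ∀ n t → im ((t +i) ^ n) ≃ 0ℝ →
    (∀ d → suc d ℕ.< n → ∀ k → 1ℚ ≤ℚ seq (im ((t +i) ^ suc d)) k) → PrimitiveRoot n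
  cot⇒primitiveRoot n t imʷⁿ≃0 imʷᵈ≥1 = record
    { root       = mkCircle η ∣η∣²≃1
    ; root^n     = unit-cancelʳ (unit-resp-≈ (ℂR.sym (conj-homo-^ w n)) (unit-^ n unit-w̄)) (begin
        η ^ n *ᶜ conj (w ^ n)  ≈⟨ η^d*conj n ⟩
        w ^ n                  ≈⟨ real⇒conj imʷⁿ≃0 ⟨
        conj (w ^ n)           ≈⟨ ℂR.*-identityˡ _ ⟨
        1ᶜ *ᶜ conj (w ^ n)     ∎)
    ; root-apart = apart
    }
    where
    w w̄ v η : ℂ
    w = t +i
    w̄ = conj w
    w̄≉0 : w̄ ≉0
    w̄≉0 = mk< 1ℚ (ℚₚ.positive⁻¹ 1ℚ) (0 , λ k _ → ≤-by (seq t k *ℚ seq t k) (square≥0 (seq t k))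
      (solve 1 (λ c → (con 0ℚ :+ con 1ℚ) :+ c :* c := c :* c :+ (:- con 1ℚ) :* (:- con 1ℚ)) refl (seq t k)))
    v = inv w̄ w̄≉0
    η = v *ᶜ w
    unit-w̄ : Unit w̄
    unit-w̄ = v , inv-inverseˡ w̄ w̄≉0
    ∣η∣²≃1 : ∣ η ∣² ≃ 1ℝ
    ∣η∣²≃1 = ≃-trans (∣∣²-* v w) (≃-trans (*ᴿ-cong (≃-refl {∣ v ∣²}) ∣w∣²≃∣w̄∣²)
      (≃-trans (≃-sym (∣∣²-* v w̄)) ∣vw̄∣²≃1))
      where
      ∣w∣²≃∣w̄∣² : ∣ w ∣² ≃ ∣ w̄ ∣²
      ∣w∣²≃∣w̄∣² = pointwise λ k → solve 1 (λ c → c :* c :+ con 1ℚ :* con 1ℚ := c :* c :+ (:- con 1ℚ) :* (:- con 1ℚ)) refl (seq t k)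
      ∣vw̄∣²≃1 : ∣ v *ᶜ w̄ ∣² ≃ 1ℝ
      ∣vw̄∣²≃1 = let (mk≈ p q) = inv-inverseˡ w̄ w̄≉0 in
        ≃-trans (+ᴿ-cong (*ᴿ-cong p p) (*ᴿ-cong q q)) (pointwise λ _ → refl)
    η^d*conj : ∀ d → η ^ d *ᶜ conj (w ^ d) ≈ᶜ w ^ d
    η^d*conj d = begin
      η ^ d *ᶜ conj (w ^ d)  ≈⟨ ℂR.*-congˡ (conj-homo-^ w d) ⟩
      η ^ d *ᶜ w̄ ^ d         ≈⟨ ^-distrib-* η w̄ d ⟨
      (v *ᶜ w *ᶜ w̄) ^ d      ≈⟨ ^-congˡ d (begin
        v *ᶜ w *ᶜ w̄            ≈⟨ ℂR.*-assoc v w w̄ ⟩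
        v *ᶜ (w *ᶜ w̄)          ≈⟨ ℂR.*-congˡ (ℂR.*-comm w w̄) ⟩
        v *ᶜ (w̄ *ᶜ w)          ≈⟨ ℂR.*-assoc v w̄ w ⟨
        v *ᶜ w̄ *ᶜ w            ≈⟨ ℂR.*-congʳ (inv-inverseˡ w̄ w̄≉0) ⟩
        1ᶜ *ᶜ w                ≈⟨ ℂR.*-identityˡ w ⟩
        w                      ∎) ⟩
      w ^ d                  ∎
    apart : ∀ k → 0 ℕ.< k → k ℕ.< n → Unit (η ^ k -ᶜ 1ᶜ)
    apart (suc d) _ d<n = unit-factorˡ (unit-resp-≈ (ℂR.sym (begin
      (η ^ suc d -ᶜ 1ᶜ) *ᶜ conj z           ≈⟨ [y-z]x≈yx-zx (conj z) (η ^ suc d) 1ᶜ ⟩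
      η ^ suc d *ᶜ conj z -ᶜ 1ᶜ *ᶜ conj z   ≈⟨ ℂR.+-cong (η^d*conj (suc d)) (ℂR.-‿cong (ℂR.*-identityˡ (conj z))) ⟩
      z -ᶜ conj z                           ∎)) (im≥1⇒unit z (imʷᵈ≥1 d d<n)))
      where
      open import Algebra.Properties.Ring ℂR.ring using ([y-z]x≈yx-zx)
      z = w ^ suc d

  primitiveRoot : ∀ n → 0 ℕ.< n → PrimitiveRoot n
  primitiveRoot (suc zero) _ = record
    { root       = AbelianGroup.ε 𝕋
    ; root^n     = ℂR.*-identityˡ 1ᶜ
    ; root-apart = λ k 0<k k<1 → contradiction k<1 (ℕₚ.≤⇒≯ 0<k)
    }
  primitiveRoot n@(suc (suc N)) _ =
    let (t , imʷⁿ≃0 , imʷᵈ≥1) = critical-cot N in cot⇒primitiveRoot n t imʷⁿ≃0 imʷᵈ≥1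

open RootsOfUnity

module _ {a ℓ} {A : Setoid a ℓ} (fin : Finite A) where
  private module A = Setoid A
  open Finite fin
  open Inverse enumeration using (strictlyInverseˡ)

  sum-reindex : ∀ {m ℓ′} (M : CommutativeMonoid m ℓ′) →
    let open CommutativeMonoid M using (Carrier; _≈_)
        open CommutativeMonoidSum M using (sum)
    in (σ : Inverse A A) (h : A.Carrier → Carrier) → (∀ {x y} → x A.≈ y → h x ≈ h y) →
       sum (h ∘ Inverse.to σ ∘ element) ≈ sum (h ∘ element)
  sum-reindex M σ h h-cong = begin
    sum (h ∘ Inverse.to σ ∘ element)
      ≈⟨ sum-cong-≋ (λ i → h-cong (A.sym (strictlyInverseˡ (Inverse.to σ (element i))))) ⟩
    sum (h ∘ element ∘ Inverse.to π)   ≈⟨ sum-permute (h ∘ element) π ⟨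
    sum (h ∘ element)                  ∎
    where
    open CommutativeMonoid M using (setoid)
    open CommutativeMonoidSum M
    open import Relation.Binary.Reasoning.Setoid setoid
    π : Inverse (≡.setoid (Fin size)) (≡.setoid (Fin size))
    π = Composition.inverse enumeration (Composition.inverse σ (Symmetry.inverse enumeration))

  infix 4 _≟_
  _≟_ : Decidable₂ A._≈_
  x ≟ y = map′ (λ eq → A.trans (A.sym (strictlyInverseˡ x)) (A.trans (A.reflexive (≡.cong element eq)) (strictlyInverseˡ y)))
               (Inverse.from-cong enumeration) (index x Finₚ.≟ index y)

module _ {a ℓ} (DS : DecSetoid a ℓ) where
  private module DS = DecSetoid DS
  open DS
  open UniqueSetoid setoid using (Unique)

  private
    lookup-injective : ∀ {xs} → Unique xs → ∀ i j → lookup xs i ≈ lookup xs j → i ≡ j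
    lookup-injective (_ AllPairs.∷ _)    Fin.zero    Fin.zero    _  = ≡.refl
    lookup-injective (x∉xs AllPairs.∷ _) Fin.zero    (Fin.suc j) eq = contradiction eq (All.lookup x∉xs (∈-lookup j))
    lookup-injective (x∉xs AllPairs.∷ _) (Fin.suc i) Fin.zero    eq = contradiction (sym eq) (All.lookup x∉xs (∈-lookup i))
    lookup-injective (_ AllPairs.∷ xs!)  (Fin.suc i) (Fin.suc j) eq = ≡.cong Fin.suc (lookup-injective xs! i j eq)

  surjection⇒finite : ∀ {m} (f : Fin m → Carrier) → (∀ x → ∃ λ i → f i ≈ x) → Finite setoid
  surjection⇒finite f surjective = record
    { size = length xs
    ; enumeration = record
      { to        = lookup xs
      ; from      = position
      ; to-cong   = λ eq → reflexive (≡.cong (lookup xs) eq)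
      ; from-cong = λ {x} {y} x≈y → injective (trans (position-lookup x) (trans x≈y (sym (position-lookup y))))
      ; inverse   = (λ { {x} ≡.refl → position-lookup x })
                  , (λ {i} {x} x≈ → injective (trans (position-lookup x) x≈))
      }
    }
    where
    xs = deduplicate DS._≟_ (tabulate f)
    injective : ∀ {i j} → lookup xs i ≈ lookup xs j → i ≡ j
    injective = lookup-injective (deduplicate-! DS (tabulate f)) _ _
    member : ∀ x → Any (_≈ x) xs
    member x = let (i , fi≈x) = surjective x in
      Anyₚ.deduplicate⁺ DS._≟_ (λ y≈z z≈x → trans y≈z z≈x) (Anyₚ.tabulate⁺ i fi≈x)
    position : Carrier → Fin (length xs)
    position x = Any.index (member x)
    position-lookup : ∀ x → lookup xs (position x) ≈ x
    position-lookup x = Anyₚ.lookup-index (member x)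

sumᶜ-delta : ∀ {a ℓ} {A : Setoid a ℓ} (fin : Finite A) → let open Setoid A in
  (h : Carrier → ℂ) → (∀ {x y} → x ≈ y → h x ≈ᶜ h y) → ∀ a → (∀ x → ¬ (x ≈ a) → h x ≈ᶜ 0ᶜ) → ∑[ fin ] h ≈ᶜ h a
sumᶜ-delta {A = A} fin h h-cong a h≈0 = single size (h ∘ element) (index a) (h-cong (strictlyInverseˡ a))
  λ i i≢ → h≈0 (element i) λ eᵢ≈a → i≢ (≡.trans (≡.sym (strictlyInverseʳ i)) (from-cong eᵢ≈a))
  where
  open Finite fin
  open Inverse enumeration using (strictlyInverseˡ; strictlyInverseʳ; from-cong)
  open CommutativeMonoidSum ℂR.+-commutativeMonoid using (sum-remove; sum-replicate-zero)
  single : ∀ n (f : Fin n → ℂ) (i : Fin n) → ∀ {z} → f i ≈ᶜ z → (∀ j → ¬ (j ≡ i) → f j ≈ᶜ 0ᶜ) → sumᶜ f ≈ᶜ z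
  single (suc n) f i fi≈z f≈0 = ℂR.trans (sum-remove {i = i} f) (ℂR.trans
    (ℂR.+-cong fi≈z (ℂR.trans (sumᶜ-cong (λ j → f≈0 (punchIn i j) (Finₚ.punchInᵢ≢i i j))) (sum-replicate-zero n)))
    (ℂR.+-identityʳ _))

open IsLocal ℂ-isLocal

module Characters {c ℓ} (G : FiniteAbelianGroup c ℓ) where
  private
    module G = FiniteAbelianGroup G
    module 𝕋 = AbelianGroup 𝕋
  open G using (Carrier; _≈_; _∙_; ε; _⁻¹; order; element; index; finite)
  open import Algebra.Properties.CommutativeMonoid.Mult G.commutativeMonoid using () renaming (_×_ to _·_)
  open import Algebra.Properties.CommutativeSemigroup G.commutativeSemigroup using (x∙yz≈y∙xz; x∙yz≈yx∙z)
  open import Algebra.Properties.CommutativeSemigroup ℂR.*-commutativeSemigroup using ()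
    renaming (x∙yz≈y∙xz to x*yz≈y*xz)
  open import Algebra.Definitions.RawMonoid 𝕋.rawMonoid using () renaming (_×_ to _·ᵀ_)
  open CommutativeMonoidSum ℂR.+-commutativeMonoid using (sum-cong-≋; ∑-distrib-+; ∑-comm; sum-replicate-zero)
  open import Algebra.Properties.Semiring.Sum ℂR.semiring using (*-distribˡ-sum)
  open import Relation.Binary.Reasoning.Setoid ℂR.setoid

  element-index : ∀ g → element (index g) ≈ g
  element-index = Inverse.strictlyInverseˡ (Finite.enumeration finite)

  translation : Carrier → Inverse G.setoid G.setoid
  translation g = record
    { to        = g ∙_
    ; from      = g ⁻¹ ∙_
    ; to-cong   = G.∙-congˡ
    ; from-cong = G.∙-congˡ
    ; inverse   = (λ y≈ → G.trans (G.∙-congˡ y≈) (\\-leftDividesˡ g _))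
                , (λ y≈ → G.trans (G.∙-congˡ y≈) (\\-leftDividesʳ g _))
    }
    where open GroupProperties G.group using (\\-leftDividesˡ; \\-leftDividesʳ)

  order-· : ∀ g → order · g ≈ ε
  order-· g = identityˡ-unique (order · g) (sum element) (G.trans
    (G.sym (G.trans (∑-distrib {order} (λ _ → g) element) (G.∙-congʳ (sum-replicate order))))
    (sum-reindex finite G.commutativeMonoid (translation g) (λ x → x) (λ x≈y → x≈y)))
    where
    open CommutativeMonoidSum G.commutativeMonoid using (sum; sum-replicate) renaming (∑-distrib-+ to ∑-distrib)
    open GroupProperties G.group using (identityˡ-unique)

  order-positive : 0 ℕ.< order
  order-positive = ℕ.>-nonZero⁻¹ order {{G.order-nonZero}}

  order-unit : Unit (fromℕ order)
  order-unit = _ , 1/n*n≈1 order {{G.order-nonZero}}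

  open PrimitiveRoot (primitiveRoot order order-positive) public

  η : ℂ
  η = val root

  open Fourier {order} {η} order-unit root^n root-apart public

  ω : ℕ → Circle
  ω j = 𝕋._⁻¹ (j ·ᵀ root)

  η^j*ω≈1 : ∀ j → η ^ j *ᶜ val (ω j) ≈ᶜ 1ᶜ
  η^j*ω≈1 j = ℂR.trans (ℂR.*-congʳ (ℂR.reflexive (≡.sym (val-· j)))) (𝕋.inverseʳ (j ·ᵀ root))
    where
    val-· : ∀ j → val (j ·ᵀ root) ≡ η ^ j
    val-· zero    = ≡.refl
    val-· (suc j) = ≡.cong (η *ᶜ_) (val-· j)

  η-solve : ∀ j {x y} → η ^ j *ᶜ x ≈ᶜ y → x ≈ᶜ val (ω j) *ᶜ y
  η-solve j {x} {y} ηx≈y = begin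
    x                                ≈⟨ ℂR.*-identityˡ x ⟨
    1ᶜ *ᶜ x                          ≈⟨ ℂR.*-congʳ (η^j*ω≈1 j) ⟨
    η ^ j *ᶜ val (ω j) *ᶜ x          ≈⟨ ℂR.*-congʳ (ℂR.*-comm (η ^ j) (val (ω j))) ⟩
    val (ω j) *ᶜ η ^ j *ᶜ x          ≈⟨ ℂR.*-assoc (val (ω j)) (η ^ j) x ⟩
    val (ω j) *ᶜ (η ^ j *ᶜ x)        ≈⟨ ℂR.*-congˡ ηx≈y ⟩
    val (ω j) *ᶜ y                   ∎

  character : (φ : Carrier → Circle) → (∀ {g h} → g ≈ h → val (φ g) ≈ᶜ val (φ h)) →
              (∀ g h → val (φ (g ∙ h)) ≈ᶜ val (φ g) *ᶜ val (φ h)) → Character G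
  character φ φ-cong homo = record
    { ⟦_⟧ = φ
    ; isGroupHomomorphism = record
      { isMonoidHomomorphism = record
        { isMagmaHomomorphism = record
          { isRelHomomorphism = record { cong = φ-cong }
          ; homo = homo
          }
        ; ε-homo = ε-homo
        }
      ; ⁻¹-homo = λ g → inverseˡ-unique (φ (g ⁻¹)) (φ g)
          (ℂR.trans (ℂR.sym (homo (g ⁻¹) g)) (ℂR.trans (φ-cong (G.inverseˡ g)) ε-homo))
      }
    }
    where
    open GroupProperties 𝕋.group using (identityˡ-unique; inverseˡ-unique)
    ε-homo : val (φ ε) ≈ᶜ 1ᶜ
    ε-homo = identityˡ-unique (φ ε) (φ ε) (ℂR.trans (ℂR.sym (homo ε ε)) (φ-cong (G.identityˡ ε)))

  eigenvector⇒character : (v : Carrier → ℂ) → (∀ {x y} → x ≈ y → v x ≈ᶜ v y) → Unit (v ε) →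
    (φ : Carrier → Circle) → (∀ g x → v (g ∙ x) ≈ᶜ val (φ g) *ᶜ v x) → Character G
  eigenvector⇒character v v-cong unit φ eigen = character φ
    (λ {g} {h} g≈h → unit-cancelʳ unit (begin
      val (φ g) *ᶜ v ε    ≈⟨ eigen g ε ⟨
      v (g ∙ ε)           ≈⟨ v-cong (G.∙-congʳ g≈h) ⟩
      v (h ∙ ε)           ≈⟨ eigen h ε ⟩
      val (φ h) *ᶜ v ε    ∎))
    (λ g h → unit-cancelʳ unit (begin
      val (φ (g ∙ h)) *ᶜ v ε              ≈⟨ eigen (g ∙ h) ε ⟨
      v (g ∙ h ∙ ε)                       ≈⟨ v-cong (G.assoc g h ε) ⟩
      v (g ∙ (h ∙ ε))                     ≈⟨ eigen g (h ∙ ε) ⟩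
      val (φ g) *ᶜ v (h ∙ ε)              ≈⟨ ℂR.*-congˡ (eigen h ε) ⟩
      val (φ g) *ᶜ (val (φ h) *ᶜ v ε)     ≈⟨ ℂR.*-assoc _ _ _ ⟨
      val (φ g) *ᶜ val (φ h) *ᶜ v ε       ∎))

  value-· : ∀ (χ : Character G) k g → Character.value χ (k · g) ≈ᶜ Character.value χ g ^ k
  value-· χ zero    g = Character.ε-homo χ
  value-· χ (suc k) g = ℂR.trans (Character.homo χ g (k · g)) (ℂR.*-congˡ (value-· χ k g))

  value^order≈1 : ∀ (χ : Character G) g → Character.value χ g ^ order ≈ᶜ 1ᶜ
  value^order≈1 χ g = ℂR.trans (ℂR.sym (value-· χ order g))
    (ℂR.trans (Character.⟦⟧-cong χ (order-· g)) (Character.ε-homo χ))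

  value-dichotomy : ∀ (χ : Character G) g → Character.value χ g ≈ᶜ 1ᶜ ⊎ Unit (Character.value χ g -ᶜ 1ᶜ)
  value-dichotomy χ g = root-dichotomy {order} order-unit (value^order≈1 χ g)

  -- Splitting v into eigenvectors of one translation after another, by the discrete Fourier
  -- transform along its orbits and always keeping a part that does not vanish at ε, ends with a
  -- multiple of a character.
  record JointEigenvector (z : Carrier) {m} (e : Fin m → Carrier) : Set (c ⊔ ℓ) where
    field
      v         : Carrier → ℂ
      v-cong    : ∀ {x y} → x ≈ y → v x ≈ᶜ v y
      v-unit    : Unit (v ε)
      orbit-sum : ∀ x → ∑<[ order ] (λ k → v (k · z ∙ x)) ≈ᶜ 0ᶜ
      exponent  : Fin m → ℕ
      eigen     : ∀ i x → η ^ exponent i *ᶜ v (e i ∙ x) ≈ᶜ v x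

  δε : Carrier → ℂ
  δε x = if does (_≟_ finite x ε) then 1ᶜ else 0ᶜ

  δε-yes : ∀ {x} → x ≈ ε → δε x ≡ 1ᶜ
  δε-yes {x} x≈ε = ≡.cong (if_then 1ᶜ else 0ᶜ) (dec-true (_≟_ finite x ε) x≈ε)

  δε-no : ∀ {x} → ¬ (x ≈ ε) → δε x ≡ 0ᶜ
  δε-no {x} x≉ε = ≡.cong (if_then 1ᶜ else 0ᶜ) (dec-false (_≟_ finite x ε) x≉ε)

  δε-cong : ∀ {x y} → x ≈ y → δε x ≈ᶜ δε y
  δε-cong {x} {y} x≈y = ℂR.reflexive (by-cases (_≟_ finite y ε))
    where
    by-cases : Dec (y ≈ ε) → δε x ≡ δε y
    by-cases (yes y≈ε) = ≡.trans (δε-yes (G.trans x≈y y≈ε)) (≡.sym (δε-yes y≈ε))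
    by-cases (no y≉ε)  = ≡.trans (δε-no (λ x≈ε → y≉ε (G.trans (G.sym x≈y) x≈ε))) (≡.sym (δε-no y≉ε))

  ·-periodic : ∀ g x → order · g ∙ x ≈ 0 · g ∙ x
  ·-periodic g x = G.∙-congʳ (order-· g)

  difference : ∀ {z} (e : Fin 0 → Carrier) → ¬ (z ≈ ε) → JointEigenvector z e
  difference {z} e z≉ε = record
    { v         = λ x → δε x -ᶜ δε (z ∙ x)
    ; v-cong    = λ x≈y → ℂR.+-cong (δε-cong x≈y) (ℂR.-‿cong (δε-cong (G.∙-congˡ x≈y)))
    ; v-unit    = unit-resp-≈ (ℂR.sym (begin
        δε ε -ᶜ δε (z ∙ ε)  ≡⟨ ≡.cong₂ _-ᶜ_ (δε-yes G.refl) (δε-no (λ zε≈ε → z≉ε (G.trans (G.sym (G.identityʳ z)) zε≈ε))) ⟩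
        1ᶜ -ᶜ 0ᶜ            ≈⟨ pointwiseᶜ (λ _ → ≡.refl) (λ _ → ≡.refl) ⟩
        1ᶜ                  ∎)) unit-1
    ; orbit-sum = orbit-sum
    ; exponent  = λ ()
    ; eigen     = λ ()
    }
    where
    open GroupProperties ℂR.+-group using (identityˡ-unique; //-rightDividesˡ)
    orbit-sum : ∀ x → ∑<[ order ] (λ k → δε (k · z ∙ x) -ᶜ δε (z ∙ (k · z ∙ x))) ≈ᶜ 0ᶜ
    orbit-sum x = identityˡ-unique _ (∑<[ order ] (f ∘ suc)) (begin
      ∑<[ order ] (λ k → f k -ᶜ δε (z ∙ (k · z ∙ x))) +ᶜ ∑<[ order ] (f ∘ suc)
        ≈⟨ ∑-distrib-+ {order} _ _ ⟨
      ∑<[ order ] (λ k → f k -ᶜ δε (z ∙ (k · z ∙ x)) +ᶜ f (suc k))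
        ≈⟨ sum-cong-≋ {order} (λ k → ℂR.trans
             (ℂR.+-congʳ (ℂR.+-congˡ (ℂR.-‿cong (δε-cong (G.sym (G.assoc z (toℕ k · z) x))))))
             (//-rightDividesˡ (f (suc (toℕ k))) (f (toℕ k)))) ⟩
      ∑<[ order ] f            ≈⟨ ∑<-shift order f (δε-cong (·-periodic z x)) ⟨
      ∑<[ order ] (f ∘ suc)  ∎)
      where
      f : ℕ → ℂ
      f k = δε (k · z ∙ x)

  refine : ∀ {z m} (e : Fin (suc m) → Carrier) → JointEigenvector z (e ∘ Fin.suc) → JointEigenvector z e
  refine {z} {m} e V = record
    { v         = v′
    ; v-cong    = λ x≈y → transform-cong (λ k → V.v-cong (G.∙-congˡ {k · g} x≈y))
    ; v-unit    = proj₂ nonvanishing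
    ; orbit-sum = orbit-sum
    ; exponent  = exponent
    ; eigen     = eigen
    }
    where
    module V = JointEigenvector V
    g = e Fin.zero
    along : Carrier → ℕ → ℂ
    along x k = V.v (k · g ∙ x)
    nonvanishing : ∃ λ (j : Fin order) → Unit (transform (along ε) (toℕ j))
    nonvanishing = transform-unit (along ε) (unit-resp-≈ (V.v-cong (G.sym (G.identityˡ ε))) V.v-unit)
    j = toℕ (proj₁ nonvanishing)
    transform-cong : ∀ {a b} → (∀ k → a k ≈ᶜ b k) → transform a j ≈ᶜ transform b j
    transform-cong a≈b = sum-cong-≋ {order} (λ k → ℂR.*-congˡ (a≈b (toℕ k)))
    v′ : Carrier → ℂ
    v′ x = transform (along x) j
    orbit-sum : ∀ x → ∑<[ order ] (λ l → v′ (l · z ∙ x)) ≈ᶜ 0ᶜ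
    orbit-sum x = begin
      ∑<[ order ] (λ l → ∑<[ order ] λ k → (η ^ j) ^ k *ᶜ V.v (k · g ∙ (l · z ∙ x)))
        ≈⟨ ∑-comm {order} {order} _ ⟩
      ∑<[ order ] (λ k → ∑<[ order ] λ l → (η ^ j) ^ k *ᶜ V.v (k · g ∙ (l · z ∙ x)))
        ≈⟨ sum-cong-≋ {order} (λ k → sum-cong-≋ {order} (λ l → ℂR.*-congˡ
             (V.v-cong (x∙yz≈y∙xz (toℕ k · g) (toℕ l · z) x)))) ⟩
      ∑<[ order ] (λ k → ∑<[ order ] λ l → (η ^ j) ^ k *ᶜ V.v (l · z ∙ (k · g ∙ x)))
        ≈⟨ sum-cong-≋ {order} (λ k → *-distribˡ-sum {order} ((η ^ j) ^ toℕ k) _) ⟨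
      ∑<[ order ] (λ k → (η ^ j) ^ k *ᶜ ∑<[ order ] λ l → V.v (l · z ∙ (k · g ∙ x)))
        ≈⟨ sum-cong-≋ {order} (λ k → ℂR.trans (ℂR.*-congˡ (V.orbit-sum (toℕ k · g ∙ x))) (ℂR.zeroʳ _)) ⟩
      ∑<[ order ] (λ _ → 0ᶜ)
        ≈⟨ sum-replicate-zero order ⟩
      0ᶜ ∎
    exponent : Fin (suc m) → ℕ
    exponent Fin.zero    = j
    exponent (Fin.suc i) = V.exponent i
    eigen : ∀ i x → η ^ exponent i *ᶜ v′ (e i ∙ x) ≈ᶜ v′ x
    eigen Fin.zero x = begin
      η ^ j *ᶜ transform (along (g ∙ x)) j
        ≈⟨ ℂR.*-congˡ (transform-cong (λ k → V.v-cong (x∙yz≈yx∙z (k · g) g x))) ⟩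
      η ^ j *ᶜ transform (along x ∘ suc) j
        ≈⟨ transform-shift (along x) (V.v-cong (·-periodic g x)) j ⟩
      transform (along x) j ∎
    eigen (Fin.suc i) x = begin
      η ^ V.exponent i *ᶜ ∑<[ order ] (λ k → (η ^ j) ^ k *ᶜ V.v (k · g ∙ (h ∙ x)))
        ≈⟨ *-distribˡ-sum {order} (η ^ V.exponent i) _ ⟩
      ∑<[ order ] (λ k → η ^ V.exponent i *ᶜ ((η ^ j) ^ k *ᶜ V.v (k · g ∙ (h ∙ x))))
        ≈⟨ sum-cong-≋ {order} (λ k → ℂR.trans
             (x*yz≈y*xz (η ^ V.exponent i) ((η ^ j) ^ toℕ k) _)
             (ℂR.*-congˡ (ℂR.trans
               (ℂR.*-congˡ (V.v-cong (x∙yz≈y∙xz (toℕ k · g) h x)))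
               (V.eigen i (toℕ k · g ∙ x))))) ⟩
      v′ x ∎
      where h = e (Fin.suc i)

  jointEigenvector : ∀ {z m} (e : Fin m → Carrier) → ¬ (z ≈ ε) → JointEigenvector z e
  jointEigenvector {m = zero}  e z≉ε = difference e z≉ε
  jointEigenvector {m = suc m} e z≉ε = refine e (jointEigenvector (e ∘ Fin.suc) z≉ε)

  separating-character : ∀ z → ¬ (z ≈ ε) → ∃ λ χ → Unit (Character.value χ z -ᶜ 1ᶜ)
  separating-character z z≉ε = χ , [ (λ χz≈1 → contradiction (trivial⇒unit χz≈1) 0-nonUnit) , (λ u → u) ]′ (value-dichotomy χ z)
    where
    open JointEigenvector (jointEigenvector element z≉ε)
    φ : Carrier → Circle
    φ g = ω (exponent (index g))
    v-eigen : ∀ g x → v (g ∙ x) ≈ᶜ val (φ g) *ᶜ v x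
    v-eigen g x = ℂR.trans (v-cong (G.∙-congʳ (G.sym (element-index g))))
      (η-solve (exponent (index g)) (eigen (index g) x))
    χ : Character G
    χ = eigenvector⇒character v v-cong v-unit φ v-eigen
    trivial⇒unit : Character.value χ z ≈ᶜ 1ᶜ → Unit 0ᶜ
    trivial⇒unit χz≈1 = unit-resp-≈ (begin
      fromℕ order *ᶜ v ε                        ≈⟨ ×-assoc-* order 1ᶜ (v ε) ⟩
      order ·ᶜ (1ᶜ *ᶜ v ε)                      ≈⟨ ×-congʳ order (ℂR.*-identityˡ (v ε)) ⟩
      order ·ᶜ v ε                              ≈⟨ sum-replicate order ⟨
      ∑<[ order ] (λ _ → v ε)                   ≈⟨ sum-cong-≋ {order} (λ k → orbit (toℕ k)) ⟨
      ∑<[ order ] (λ k → v (k · z ∙ ε))         ≈⟨ orbit-sum ε ⟩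
      0ᶜ                                        ∎) (unit-* order-unit v-unit)
      where
      open import Algebra.Properties.Semiring.Mult ℂR.semiring using (×-assoc-*; ×-congʳ)
      open CommutativeMonoidSum ℂR.+-commutativeMonoid using (sum-replicate)
      orbit : ∀ k → v (k · z ∙ ε) ≈ᶜ v ε
      orbit zero    = v-cong (G.identityˡ ε)
      orbit (suc k) = begin
        v (z ∙ k · z ∙ ε)               ≈⟨ v-cong (G.assoc z (k · z) ε) ⟩
        v (z ∙ (k · z ∙ ε))             ≈⟨ v-eigen z (k · z ∙ ε) ⟩
        val (φ z) *ᶜ v (k · z ∙ ε)      ≈⟨ ℂR.*-cong χz≈1 (orbit k) ⟩
        1ᶜ *ᶜ v ε                       ≈⟨ ℂR.*-identityˡ (v ε) ⟩
        v ε                             ∎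

module Duality {c ℓ} (G : FiniteAbelianGroup c ℓ) where
  private
    module G = FiniteAbelianGroup G
    module 𝕋 = AbelianGroup 𝕋
    module Ĝ = Setoid (dual G)
  open G using (Carrier; _≈_; _∙_; ε; _⁻¹; order; element; index; finite)
  open Characters G
  open Character using (value)
  open CommutativeMonoidSum ℂR.+-commutativeMonoid using (∑-comm; sum-replicate)
  open import Algebra.Properties.CommutativeSemigroup ℂR.*-commutativeSemigroup using (interchange)
  open import Algebra.Properties.Semiring.Sum ℂR.semiring using (*-distribˡ-sum)
  open import Relation.Binary.Reasoning.Setoid ℂR.setoid

  Root : Circle → Set
  Root u = val u ^ order ≈ᶜ 1ᶜ

  root-∙ : ∀ u w → Root u → Root w → Root (u 𝕋.∙ w)
  root-∙ u w uⁿ≈1 wⁿ≈1 = ℂR.trans (^-distrib-* (val u) (val w) order)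
    (ℂR.trans (ℂR.*-cong uⁿ≈1 wⁿ≈1) (ℂR.*-identityˡ 1ᶜ))

  root-⁻¹ : ∀ u → Root u → Root (u 𝕋.⁻¹)
  root-⁻¹ u uⁿ≈1 = ℂR.trans (ℂR.sym (conj-homo-^ (val u) order))
    (ℂR.trans (conj-cong uⁿ≈1) (pointwiseᶜ (λ _ → ≡.refl) (λ _ → ≡.refl)))

  root-ω : ∀ j → Root (ω j)
  root-ω j = begin
    val (ω j) ^ order                             ≈⟨ ℂR.*-identityˡ _ ⟨
    1ᶜ *ᶜ val (ω j) ^ order                       ≈⟨ ℂR.*-congʳ (^-root {n = order} root^n j) ⟨
    (η ^ j) ^ order *ᶜ val (ω j) ^ order          ≈⟨ ^-distrib-* (η ^ j) (val (ω j)) order ⟨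
    (η ^ j *ᶜ val (ω j)) ^ order                  ≈⟨ ^-congˡ order (η^j*ω≈1 j) ⟩
    1ᶜ ^ order                                    ≈⟨ 1^n≈1 order ⟩
    1ᶜ                                            ∎

  root-≟ : ∀ u w → Root u → Root w → Dec (val u ≈ᶜ val w)
  root-≟ u w uⁿ≈1 wⁿ≈1 = decide (root-dichotomy {order} order-unit (root-∙ u (w 𝕋.⁻¹) uⁿ≈1 (root-⁻¹ w wⁿ≈1)))
    where
    q = u 𝕋.∙ w 𝕋.⁻¹
    open GroupProperties 𝕋.group using (x∙y⁻¹≈ε⇒x≈y; x≈y⇒x∙y⁻¹≈ε)
    decide : val q ≈ᶜ 1ᶜ ⊎ Unit (val q -ᶜ 1ᶜ) → Dec (val u ≈ᶜ val w)
    decide (inj₁ q≈1)  = yes (x∙y⁻¹≈ε⇒x≈y u w q≈1)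
    decide (inj₂ unit) = no λ u≈w → 0-nonUnit (unit-resp-≈
      (ℂR.trans (ℂR.+-congʳ (x≈y⇒x∙y⁻¹≈ε {u} {w} u≈w)) (ℂR.-‿inverseʳ 1ᶜ)) unit)

  trivial : Character G
  trivial = character (λ _ → 𝕋.ε) (λ _ → ℂR.refl) (λ _ _ → ℂR.sym (ℂR.*-identityˡ 1ᶜ))

  private
    root-character : (Fin order → Fin order) → Carrier → Circle
    root-character f g = ω (toℕ (f (index g)))

    Homomorphic : (Fin order → Fin order) → Set
    Homomorphic f = ∀ i j → val (root-character f (element i ∙ element j)) ≈ᶜ val (ω (toℕ (f i))) *ᶜ val (ω (toℕ (f j)))

    homomorphic? : ∀ f → Dec (Homomorphic f)
    homomorphic? f = Finₚ.all? λ i → Finₚ.all? λ j →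
      root-≟ (root-character f (element i ∙ element j)) (ω (toℕ (f i)) 𝕋.∙ ω (toℕ (f j)))
        (root-ω (toℕ (f (index (element i ∙ element j)))))
        (root-∙ (ω (toℕ (f i))) (ω (toℕ (f j))) (root-ω (toℕ (f i))) (root-ω (toℕ (f j))))

    index-cong : ∀ {g h} → g ≈ h → index g ≡ index h
    index-cong = Inverse.from-cong (Finite.enumeration finite)

    root-character-cong : ∀ f {g h} → g ≈ h → val (root-character f g) ≈ᶜ val (root-character f h)
    root-character-cong f g≈h = ℂR.reflexive (≡.cong (λ i → val (ω (toℕ (f i)))) (index-cong g≈h))

    toCharacter : ∀ f → Dec (Homomorphic f) → Character G
    toCharacter f (no _)     = trivial
    toCharacter f (yes homo) = character (root-character f) (root-character-cong f)
      (λ g h → ℂR.trans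
        (root-character-cong f (G.∙-cong (G.sym (element-index g)) (G.sym (element-index h))))
        (homo (index g) (index h)))

    toCharacter-≈ : ∀ f χ → (∀ i → val (ω (toℕ (f i))) ≈ᶜ value χ (element i)) →
                    ∀ d → toCharacter f d Ĝ.≈ χ
    toCharacter-≈ f χ f≈χ (yes _) g = ℂR.trans (f≈χ (index g)) (Character.⟦⟧-cong χ (element-index g))
    toCharacter-≈ f χ f≈χ (no ¬homo) = contradiction homo ¬homo
      where
      homo : Homomorphic f
      homo i j = begin
        val (root-character f (element i ∙ element j))       ≈⟨ f≈χ _ ⟩
        value χ (element (index (element i ∙ element j)))    ≈⟨ Character.⟦⟧-cong χ (element-index _) ⟩
        value χ (element i ∙ element j)                      ≈⟨ Character.homo χ _ _ ⟩
        value χ (element i) *ᶜ value χ (element j)           ≈⟨ ℂR.*-cong (f≈χ i) (f≈χ j) ⟨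
        val (ω (toℕ (f i))) *ᶜ val (ω (toℕ (f j)))           ∎

  character-≟ : Decidable₂ Ĝ._≈_
  character-≟ χ ψ = map′
    (λ eq g → ℂR.trans (Character.⟦⟧-cong χ (G.sym (element-index g)))
      (ℂR.trans (eq (index g)) (Character.⟦⟧-cong ψ (element-index g))))
    (λ eq i → eq (element i))
    (Finₚ.all? λ i → root-≟ (Character.⟦_⟧ χ (element i)) (Character.⟦_⟧ ψ (element i))
      (value^order≈1 χ (element i)) (value^order≈1 ψ (element i)))

  dual-finite : Finite (dual G)
  dual-finite = surjection⇒finite
    (record { isDecEquivalence = record { isEquivalence = Ĝ.isEquivalence ; _≟_ = character-≟ } })
    {order ℕ.^ order} (λ i → toCharacter (finToFun i) (homomorphic? (finToFun i)))
    λ χ → funToFin (exponents χ)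
        , toCharacter-≈ (finToFun (funToFin (exponents χ))) χ
            (λ i → ℂR.trans (ℂR.reflexive (≡.cong (λ j → val (ω (toℕ j))) (Finₚ.finToFun-funToFin (exponents χ) i)))
                            (ω-exponents χ i))
            (homomorphic? (finToFun (funToFin (exponents χ))))
    where
    exponents : Character G → Fin order → Fin order
    exponents χ i = proj₁ (locate-root (value^order≈1 χ (element i)))
    ω-exponents : ∀ χ i → val (ω (toℕ (exponents χ i))) ≈ᶜ value χ (element i)
    ω-exponents χ i = ℂR.sym (ℂR.trans
      (η-solve (toℕ (exponents χ i)) (proj₂ (locate-root (value^order≈1 χ (element i)))))
      (ℂR.*-identityʳ _))

  infixl 7 _⊗_
  _⊗_ : Character G → Character G → Character G
  χ ⊗ ψ = character (λ g → Character.⟦_⟧ χ g 𝕋.∙ Character.⟦_⟧ ψ g)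
    (λ g≈h → ℂR.*-cong (Character.⟦⟧-cong χ g≈h) (Character.⟦⟧-cong ψ g≈h))
    (λ g h → ℂR.trans (ℂR.*-cong (Character.homo χ g h) (Character.homo ψ g h)) (interchange _ _ _ _))

  conjugate : Character G → Character G
  conjugate χ = character (λ g → Character.⟦_⟧ χ g 𝕋.⁻¹)
    (λ g≈h → conj-cong (Character.⟦⟧-cong χ g≈h))
    (λ g h → ℂR.trans (conj-cong (Character.homo χ g h)) (conj-homo-* _ _))

  multiplication : Character G → Inverse (dual G) (dual G)
  multiplication ψ = record
    { to        = ψ ⊗_
    ; from      = conjugate ψ ⊗_
    ; to-cong   = λ χ≈χ′ g → ℂR.*-congˡ (χ≈χ′ g)
    ; from-cong = λ χ≈χ′ g → ℂR.*-congˡ (χ≈χ′ g)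
    ; inverse   = (λ {χ} χ≈ g → ℂR.trans (ℂR.*-congˡ (χ≈ g)) (\\-leftDividesˡ (Character.⟦_⟧ ψ g) (Character.⟦_⟧ χ g)))
                , (λ {χ} χ≈ g → ℂR.trans (ℂR.*-congˡ (χ≈ g)) (\\-leftDividesʳ (Character.⟦_⟧ ψ g) (Character.⟦_⟧ χ g)))
    }
    where open GroupProperties 𝕋.group using (\\-leftDividesˡ; \\-leftDividesʳ)

  ∑-character : ∀ χ → ¬ (χ Ĝ.≈ trivial) → ∑[ finite ] value χ ≈ᶜ 0ᶜ
  ∑-character χ χ≉1 = fixed⇒≈0 (proj₂ separated) (begin
    value χ g *ᶜ ∑[ finite ] value χ               ≈⟨ *-distribˡ-sum {order} (value χ g) _ ⟩
    ∑[ finite ] (λ x → value χ g *ᶜ value χ x)     ≈⟨ sumᶜ-cong (λ i → Character.homo χ g (element i)) ⟨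
    ∑[ finite ] (λ x → value χ (g ∙ x))
      ≈⟨ sum-reindex finite ℂR.+-commutativeMonoid (translation g) (value χ) (Character.⟦⟧-cong χ) ⟩
    ∑[ finite ] value χ                            ∎)
    where
    separated : ∃ λ g → Unit (value χ g -ᶜ 1ᶜ)
    separated =
      let (i , χeᵢ≉1) = Finₚ.¬∀⟶∃¬ order (λ i → value χ (element i) ≈ᶜ 1ᶜ)
            (λ i → root-≟ (Character.⟦_⟧ χ (element i)) 𝕋.ε (value^order≈1 χ (element i)) (1^n≈1 order))
            (λ eq → χ≉1 (λ g → ℂR.trans (Character.⟦⟧-cong χ (G.sym (element-index g))) (eq (index g))))
      in element i , [ (λ χeᵢ≈1 → contradiction χeᵢ≈1 χeᵢ≉1) , (λ u → u) ]′ (value-dichotomy χ (element i))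
    g = proj₁ separated

  module _ (Ĝ : Finite (dual G)) where

    ∑-dual : ∀ z → ¬ (z ≈ ε) → ∑[ Ĝ ] (λ χ → value χ z) ≈ᶜ 0ᶜ
    ∑-dual z z≉ε = let (ψ , unit) = separating-character z z≉ε in fixed⇒≈0 unit (begin
      value ψ z *ᶜ ∑[ Ĝ ] (λ χ → value χ z)          ≈⟨ *-distribˡ-sum {Finite.size Ĝ} (value ψ z) _ ⟩
      ∑[ Ĝ ] (λ χ → value (ψ ⊗ χ) z)
        ≈⟨ sum-reindex Ĝ ℂR.+-commutativeMonoid (multiplication ψ) (λ χ → value χ z) (λ χ≈χ′ → χ≈χ′ z) ⟩
      ∑[ Ĝ ] (λ χ → value χ z)                       ∎)

    ∑-dual-cong : ∀ {y z} → y ≈ z → ∑[ Ĝ ] (λ χ → value χ y) ≈ᶜ ∑[ Ĝ ] (λ χ → value χ z)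
    ∑-dual-cong {y} {z} y≈z = ∑-cong Ĝ (λ χ → value χ y) (λ χ → value χ z) (λ χ → Character.⟦⟧-cong χ y≈z)

    -- Both sides are the sum of all entries of the character table.
    ∑-dual-ε : ∑[ Ĝ ] (λ χ → value χ ε) ≈ᶜ fromℕ order
    ∑-dual-ε = begin
      ∑[ Ĝ ] (λ χ → value χ ε)                            ≈⟨ sumᶜ-delta finite (λ z → ∑[ Ĝ ] λ χ → value χ z) ∑-dual-cong ε ∑-dual ⟨
      ∑[ finite ] (λ z → ∑[ Ĝ ] λ χ → value χ z)          ≈⟨ ∑-comm (λ i k → value (Finite.element Ĝ k) (element i)) ⟩
      ∑[ Ĝ ] (λ χ → ∑[ finite ] value χ)
        ≈⟨ sumᶜ-delta Ĝ (λ χ → ∑[ finite ] value χ) (λ {χ} {ψ} χ≈ψ → ∑-cong finite (value χ) (value ψ) χ≈ψ) trivial ∑-character ⟩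
      ∑[ finite ] (λ _ → 1ᶜ)                              ≈⟨ sum-replicate order ⟩
      fromℕ order                                         ∎

module GreenFunction {c ℓ p} (G : FiniteAbelianGroup c ℓ) (S : SymmetricSubset G p)
  {α₀ : ℝ} (α₀>0 : 0ℝ < α₀) (Ĝ : Finite (dual G)) where
  private module G = FiniteAbelianGroup G
  open G using (Carrier; _≈_; _∙_; ε; _⁻¹; order; element; finite)
  open Diffusion G S
  open SymmetricSubset S using (_∈S?)
  open Character using (value)
  open Characters G using (translation)
  open Duality G using (∑-dual; ∑-dual-cong; ∑-dual-ε)
  open CommutativeMonoidSum ℂR.+-commutativeMonoid using (sum-cong-≋; ∑-comm; ∑-distrib-+)
  open import Algebra.Properties.CommutativeSemigroup ℂR.*-commutativeSemigroup
    using (x∙yz≈y∙xz; xy∙z≈xz∙y)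
  open import Algebra.Properties.Ring ℂR.ring using ([y-z]x≈yx-zx; -‿distribʳ-*)
  open import Algebra.Properties.AbelianGroup ℂR.+-abelianGroup using (⁻¹-∙-comm)
  open import Algebra.Properties.Semiring.Sum ℂR.semiring using (*-distribˡ-sum; *-distribʳ-sum)
  open import Relation.Binary.Reasoning.Setoid ℂR.setoid

  sum-neg : ∀ {n} (t : Fin n → ℂ) → -ᶜ sumᶜ t ≈ᶜ sumᶜ (λ i → -ᶜ t i)
  sum-neg {zero}  t = pointwiseᶜ (λ _ → ≡.refl) (λ _ → ≡.refl)
  sum-neg {suc n} t = ℂR.trans (ℂR.sym (⁻¹-∙-comm (t Fin.zero) _)) (ℂR.+-congˡ (sum-neg (t ∘ Fin.suc)))

  transform : (Carrier → ℂ) → Character G → ℂ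
  transform f χ = ∑[ finite ] λ y → f y *ᶜ conj (value χ y)

  hamiltonian : (Carrier → ℂ) → Carrier → ℂ
  hamiltonian f x = laplacian f x +ᶜ fromℝ α₀ *ᶜ f x

  symbol weight : Character G → ℂ
  symbol χ = eigenvalue χ +ᶜ fromℝ α₀
  weight χ = inv (symbol χ) (eigenvalue+α₀≉0 χ α₀>0)

  value-⁻¹∙ : ∀ (χ : Character G) y x → value χ (y ⁻¹ ∙ x) ≈ᶜ conj (value χ y) *ᶜ value χ x
  value-⁻¹∙ χ y x = ℂR.trans (Character.homo χ (y ⁻¹) x) (ℂR.*-congʳ (Character.⁻¹-homo χ y))

  inversion : ∀ f → (∀ {x y} → x ≈ y → f x ≈ᶜ f y) → ∀ x →
              ∑[ Ĝ ] (λ χ → 1/∣G∣ *ᶜ transform f χ *ᶜ value χ x) ≈ᶜ f x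
  inversion f f-cong x = begin
    ∑[ Ĝ ] (λ χ → 1/∣G∣ *ᶜ transform f χ *ᶜ value χ x)
      ≈⟨ sum-cong-≋ {Finite.size Ĝ} (λ k → ℂR.*-assoc 1/∣G∣ _ _) ⟩
    ∑[ Ĝ ] (λ χ → 1/∣G∣ *ᶜ (transform f χ *ᶜ value χ x))
      ≈⟨ *-distribˡ-sum {Finite.size Ĝ} 1/∣G∣ _ ⟨
    1/∣G∣ *ᶜ ∑[ Ĝ ] (λ χ → transform f χ *ᶜ value χ x)
      ≈⟨ ℂR.*-congˡ (sum-cong-≋ {Finite.size Ĝ} (λ k → ℂR.trans
           (*-distribʳ-sum {order} (value (Finite.element Ĝ k) x) _)
           (sum-cong-≋ {order} (λ i → ℂR.trans (ℂR.*-assoc (f (element i)) _ _)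
             (ℂR.*-congˡ (ℂR.sym (value-⁻¹∙ (Finite.element Ĝ k) (element i) x))))))) ⟩
    1/∣G∣ *ᶜ ∑[ Ĝ ] (λ χ → ∑[ finite ] λ y → f y *ᶜ value χ (y ⁻¹ ∙ x))
      ≈⟨ ℂR.*-congˡ (∑-comm {Finite.size Ĝ} {order} _) ⟩
    1/∣G∣ *ᶜ ∑[ finite ] (λ y → ∑[ Ĝ ] λ χ → f y *ᶜ value χ (y ⁻¹ ∙ x))
      ≈⟨ ℂR.*-congˡ (sum-cong-≋ {order} (λ i → *-distribˡ-sum {Finite.size Ĝ} (f (element i)) _)) ⟨
    1/∣G∣ *ᶜ ∑[ finite ] (λ y → f y *ᶜ ∑[ Ĝ ] λ χ → value χ (y ⁻¹ ∙ x))
      ≈⟨ ℂR.*-congˡ (sumᶜ-delta finite (λ y → f y *ᶜ ∑[ Ĝ ] λ χ → value χ (y ⁻¹ ∙ x))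
           (λ y≈z → ℂR.*-cong (f-cong y≈z) (∑-dual-cong Ĝ (G.∙-congʳ (G.⁻¹-cong y≈z)))) x
           (λ y y≉x → ℂR.trans (ℂR.*-congˡ (∑-dual Ĝ (y ⁻¹ ∙ x) (λ eq → y≉x (y⁻¹∙x≈ε⇒y≈x y eq)))) (ℂR.zeroʳ (f y)))) ⟩
    1/∣G∣ *ᶜ (f x *ᶜ ∑[ Ĝ ] λ χ → value χ (x ⁻¹ ∙ x))
      ≈⟨ ℂR.*-congˡ (ℂR.*-congˡ (ℂR.trans (∑-dual-cong Ĝ (G.inverseˡ x)) (∑-dual-ε Ĝ))) ⟩
    1/∣G∣ *ᶜ (f x *ᶜ fromℕ order)
      ≈⟨ x∙yz≈y∙xz 1/∣G∣ (f x) (fromℕ order) ⟩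
    f x *ᶜ (1/∣G∣ *ᶜ fromℕ order)
      ≈⟨ ℂR.*-congˡ (1/n*n≈1 order {{G.order-nonZero}}) ⟩
    f x *ᶜ 1ᶜ
      ≈⟨ ℂR.*-identityʳ (f x) ⟩
    f x ∎
    where
    open GroupProperties G.group using (inverseʳ-unique; ⁻¹-involutive)
    y⁻¹∙x≈ε⇒y≈x : ∀ y → y ⁻¹ ∙ x ≈ ε → y ≈ x
    y⁻¹∙x≈ε⇒y≈x y eq = G.sym (G.trans (inverseʳ-unique (y ⁻¹) x eq) (⁻¹-involutive y))

  eigenvalue≈ : ∀ χ → eigenvalue χ ≈ᶜ k -ᶜ transform δS χ
  eigenvalue≈ χ = ℂR.+-congˡ (ℂR.-‿cong (sum-cong-≋ {order} (λ i → indicator (element i))))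
    where
    indicator : ∀ y → (if does (y ∈S?) then conj (value χ y) else 0ᶜ) ≈ᶜ δS y *ᶜ conj (value χ y)
    indicator y with does (y ∈S?)
    ... | true  = ℂR.sym (ℂR.*-identityˡ _)
    ... | false = ℂR.sym (ℂR.zeroˡ _)

  symbol-* : ∀ χ z → k *ᶜ z -ᶜ transform δS χ *ᶜ z +ᶜ fromℝ α₀ *ᶜ z ≈ᶜ symbol χ *ᶜ z
  symbol-* χ z = begin
    k *ᶜ z -ᶜ transform δS χ *ᶜ z +ᶜ fromℝ α₀ *ᶜ z   ≈⟨ ℂR.+-congʳ ([y-z]x≈yx-zx z k (transform δS χ)) ⟨
    (k -ᶜ transform δS χ) *ᶜ z +ᶜ fromℝ α₀ *ᶜ z      ≈⟨ ℂR.distribʳ z _ _ ⟨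
    (k -ᶜ transform δS χ +ᶜ fromℝ α₀) *ᶜ z           ≈⟨ ℂR.*-congʳ (ℂR.+-congʳ (eigenvalue≈ χ)) ⟨
    symbol χ *ᶜ z                                    ∎

  hamiltonian-character : ∀ χ x → hamiltonian (value χ) x ≈ᶜ symbol χ *ᶜ value χ x
  hamiltonian-character χ x = ℂR.trans
    (ℂR.+-congʳ (ℂR.+-congˡ (ℂR.-‿cong (begin
      ∑[ finite ] (λ y → δS y *ᶜ value χ (y ⁻¹ ∙ x))
        ≈⟨ sum-cong-≋ {order} (λ i → ℂR.trans (ℂR.*-congˡ (value-⁻¹∙ χ (element i) x))
             (ℂR.sym (ℂR.*-assoc (δS (element i)) _ _))) ⟩
      ∑[ finite ] (λ y → δS y *ᶜ conj (value χ y) *ᶜ value χ x)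
        ≈⟨ *-distribʳ-sum {order} (value χ x) _ ⟨
      transform δS χ *ᶜ value χ x ∎))))
    (symbol-* χ (value χ x))

  hamiltonian-cong : ∀ {f g} → (∀ x → f x ≈ᶜ g x) → ∀ x → hamiltonian f x ≈ᶜ hamiltonian g x
  hamiltonian-cong f≈g x = ℂR.+-cong
    (ℂR.+-cong (ℂR.*-congˡ (f≈g x)) (ℂR.-‿cong (sum-cong-≋ {order} (λ i → ℂR.*-congˡ (f≈g (element i ⁻¹ ∙ x))))))
    (ℂR.*-congˡ (f≈g x))

  hamiltonian-∑ : ∀ {n} (a : Fin n → ℂ) (f : Fin n → Carrier → ℂ) x →
    hamiltonian (λ x → sumᶜ λ i → a i *ᶜ f i x) x ≈ᶜ sumᶜ (λ i → a i *ᶜ hamiltonian (f i) x)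
  hamiltonian-∑ {n} a f x = begin
    k *ᶜ ∑af x -ᶜ (δS ∗ ∑af) x +ᶜ fromℝ α₀ *ᶜ ∑af x
      ≈⟨ ℂR.+-cong (ℂR.+-cong (scale-∑ k) (ℂR.trans (ℂR.-‿cong convolution-∑) (sum-neg {n} _))) (scale-∑ (fromℝ α₀)) ⟩
    sumᶜ (λ i → a i *ᶜ (k *ᶜ f i x)) +ᶜ sumᶜ (λ i → -ᶜ (a i *ᶜ (δS ∗ f i) x)) +ᶜ sumᶜ (λ i → a i *ᶜ (fromℝ α₀ *ᶜ f i x))
      ≈⟨ ℂR.+-congʳ (∑-distrib-+ {n} _ _) ⟨
    sumᶜ (λ i → a i *ᶜ (k *ᶜ f i x) +ᶜ -ᶜ (a i *ᶜ (δS ∗ f i) x)) +ᶜ sumᶜ (λ i → a i *ᶜ (fromℝ α₀ *ᶜ f i x))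
      ≈⟨ ∑-distrib-+ {n} _ _ ⟨
    sumᶜ (λ i → a i *ᶜ (k *ᶜ f i x) +ᶜ -ᶜ (a i *ᶜ (δS ∗ f i) x) +ᶜ a i *ᶜ (fromℝ α₀ *ᶜ f i x))
      ≈⟨ sum-cong-≋ {n} (λ i → ℂR.trans
           (ℂR.+-congʳ (ℂR.trans (ℂR.+-congˡ (-‿distribʳ-* (a i) _)) (ℂR.sym (ℂR.distribˡ (a i) _ _))))
           (ℂR.sym (ℂR.distribˡ (a i) _ _))) ⟩
    sumᶜ (λ i → a i *ᶜ hamiltonian (f i) x) ∎
    where
    ∑af : Carrier → ℂ
    ∑af x = sumᶜ λ i → a i *ᶜ f i x
    scale-∑ : ∀ c {x} → c *ᶜ ∑af x ≈ᶜ sumᶜ (λ i → a i *ᶜ (c *ᶜ f i x))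
    scale-∑ c {x} = ℂR.trans (*-distribˡ-sum {n} c _) (sum-cong-≋ {n} (λ i → x∙yz≈y∙xz c (a i) (f i x)))
    convolution-∑ : (δS ∗ ∑af) x ≈ᶜ sumᶜ (λ i → a i *ᶜ (δS ∗ f i) x)
    convolution-∑ = begin
      ∑[ finite ] (λ y → δS y *ᶜ ∑af (y ⁻¹ ∙ x))
        ≈⟨ sum-cong-≋ {order} (λ j → scale-∑ (δS (element j))) ⟩
      ∑[ finite ] (λ y → sumᶜ λ i → a i *ᶜ (δS y *ᶜ f i (y ⁻¹ ∙ x)))
        ≈⟨ ∑-comm {order} {n} _ ⟩
      sumᶜ (λ i → ∑[ finite ] λ y → a i *ᶜ (δS y *ᶜ f i (y ⁻¹ ∙ x)))
        ≈⟨ sum-cong-≋ {n} (λ i → *-distribˡ-sum {order} (a i) _) ⟨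
      sumᶜ (λ i → a i *ᶜ (δS ∗ f i) x) ∎

  transform-hamiltonian : ∀ f → (∀ {x y} → x ≈ y → f x ≈ᶜ f y) → ∀ χ →
    transform (hamiltonian f) χ ≈ᶜ symbol χ *ᶜ transform f χ
  transform-hamiltonian f f-cong χ = begin
    ∑[ finite ] (λ y → hamiltonian f y *ᶜ v y)
      ≈⟨ sum-cong-≋ {order} (λ i → expand (element i)) ⟩
    ∑[ finite ] (λ y → k *ᶜ (f y *ᶜ v y) +ᶜ -ᶜ ((δS ∗ f) y *ᶜ v y) +ᶜ fromℝ α₀ *ᶜ (f y *ᶜ v y))
      ≈⟨ ∑-distrib-+ {order} _ _ ⟩
    ∑[ finite ] (λ y → k *ᶜ (f y *ᶜ v y) +ᶜ -ᶜ ((δS ∗ f) y *ᶜ v y)) +ᶜ ∑[ finite ] (λ y → fromℝ α₀ *ᶜ (f y *ᶜ v y))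
      ≈⟨ ℂR.+-cong (∑-distrib-+ {order} _ _) (ℂR.sym (*-distribˡ-sum {order} (fromℝ α₀) _)) ⟩
    ∑[ finite ] (λ y → k *ᶜ (f y *ᶜ v y)) +ᶜ ∑[ finite ] (λ y → -ᶜ ((δS ∗ f) y *ᶜ v y)) +ᶜ fromℝ α₀ *ᶜ transform f χ
      ≈⟨ ℂR.+-congʳ (ℂR.+-cong (ℂR.sym (*-distribˡ-sum {order} k _)) (ℂR.trans (ℂR.sym (sum-neg {order} _)) (ℂR.-‿cong convolution))) ⟩
    k *ᶜ transform f χ -ᶜ transform δS χ *ᶜ transform f χ +ᶜ fromℝ α₀ *ᶜ transform f χ
      ≈⟨ symbol-* χ (transform f χ) ⟩
    symbol χ *ᶜ transform f χ ∎
    where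
    v : Carrier → ℂ
    v y = conj (value χ y)
    v-cong : ∀ {x y} → x ≈ y → v x ≈ᶜ v y
    v-cong x≈y = conj-cong (Character.⟦⟧-cong χ x≈y)
    expand : ∀ y → hamiltonian f y *ᶜ v y
                     ≈ᶜ k *ᶜ (f y *ᶜ v y) +ᶜ -ᶜ ((δS ∗ f) y *ᶜ v y) +ᶜ fromℝ α₀ *ᶜ (f y *ᶜ v y)
    expand y = ℂR.trans (ℂR.distribʳ (v y) _ _) (ℂR.+-cong
      (ℂR.trans ([y-z]x≈yx-zx (v y) _ _) (ℂR.+-congʳ (ℂR.*-assoc k (f y) (v y))))
      (ℂR.*-assoc (fromℝ α₀) (f y) (v y)))
    convolution : ∑[ finite ] (λ y → (δS ∗ f) y *ᶜ v y) ≈ᶜ transform δS χ *ᶜ transform f χ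
    convolution = begin
      ∑[ finite ] (λ y → (∑[ finite ] λ z → δS z *ᶜ f (z ⁻¹ ∙ y)) *ᶜ v y)
        ≈⟨ sum-cong-≋ {order} (λ i → ℂR.trans (*-distribʳ-sum {order} (v (element i)) _)
             (sum-cong-≋ {order} (λ j → ℂR.*-assoc (δS (element j)) _ (v (element i))))) ⟩
      ∑[ finite ] (λ y → ∑[ finite ] λ z → δS z *ᶜ (f (z ⁻¹ ∙ y) *ᶜ v y))
        ≈⟨ ∑-comm {order} {order} _ ⟩
      ∑[ finite ] (λ z → ∑[ finite ] λ y → δS z *ᶜ (f (z ⁻¹ ∙ y) *ᶜ v y))
        ≈⟨ sum-cong-≋ {order} (λ i → ℂR.trans (ℂR.sym (*-distribˡ-sum {order} (δS (element i)) _))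
             (ℂR.*-congˡ (shifted (element i)))) ⟩
      ∑[ finite ] (λ z → δS z *ᶜ (v z *ᶜ transform f χ))
        ≈⟨ sum-cong-≋ {order} (λ i → ℂR.*-assoc (δS (element i)) _ _) ⟨
      ∑[ finite ] (λ z → δS z *ᶜ v z *ᶜ transform f χ)
        ≈⟨ *-distribʳ-sum {order} (transform f χ) _ ⟨
      transform δS χ *ᶜ transform f χ ∎
      where
      shifted : ∀ z → ∑[ finite ] (λ y → f (z ⁻¹ ∙ y) *ᶜ v y) ≈ᶜ v z *ᶜ transform f χ
      shifted z = begin
        ∑[ finite ] (λ y → f (z ⁻¹ ∙ y) *ᶜ v y)
          ≈⟨ sum-reindex finite ℂR.+-commutativeMonoid (translation z) (λ y → f (z ⁻¹ ∙ y) *ᶜ v y)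
               (λ x≈y → ℂR.*-cong (f-cong (G.∙-congˡ x≈y)) (v-cong x≈y)) ⟨
        ∑[ finite ] (λ y → f (z ⁻¹ ∙ (z ∙ y)) *ᶜ v (z ∙ y))
          ≈⟨ sum-cong-≋ {order} (λ i → ℂR.trans
               (ℂR.*-cong (f-cong (\\-leftDividesʳ z (element i)))
                 (ℂR.trans (conj-cong (Character.homo χ z (element i))) (conj-homo-* _ _)))
               (x∙yz≈y∙xz (f (element i)) (v z) (v (element i)))) ⟩
        ∑[ finite ] (λ y → v z *ᶜ (f y *ᶜ v y))
          ≈⟨ *-distribˡ-sum {order} (v z) _ ⟨
        v z *ᶜ transform f χ ∎
        where open GroupProperties G.group using (\\-leftDividesʳ)

  green-expansion : ∀ f x → green α₀>0 Ĝ f ⟨$⟩ x ≈ᶜ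
    ∑[ Ĝ ] (λ χ → 1/∣G∣ *ᶜ (weight χ *ᶜ transform (f ⟨$⟩_) χ) *ᶜ value χ x)
  green-expansion f x = ℂR.trans (*-distribˡ-sum {Finite.size Ĝ} 1/∣G∣ _)
    (sum-cong-≋ {Finite.size Ĝ} (λ i → let χ = Finite.element Ĝ i in ℂR.trans
      (ℂR.*-congˡ (ℂR.trans (ℂR.sym (*-distribʳ-sum {order} (value χ x) _))
        (ℂR.*-congʳ (ℂR.trans (sum-cong-≋ {order} (λ j → ℂR.*-assoc (weight χ) _ _))
          (ℂR.sym (*-distribˡ-sum {order} (weight χ) _))))))
      (ℂR.sym (ℂR.*-assoc 1/∣G∣ _ (value χ x)))))

  green-cong : ∀ f h → (∀ x → f ⟨$⟩ x ≈ᶜ h ⟨$⟩ x) → ∀ x → green α₀>0 Ĝ f ⟨$⟩ x ≈ᶜ green α₀>0 Ĝ h ⟨$⟩ x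
  green-cong f h f≈h x = ℂR.*-congˡ {1/∣G∣} (sum-cong-≋ {Finite.size Ĝ} (λ i → sum-cong-≋ {order} (λ j →
    let χ = Finite.element Ĝ i in
    ℂR.*-congʳ {value χ x} (ℂR.*-congʳ {conj (value χ (element j))} (ℂR.*-congˡ {weight χ} (f≈h (element j)))))))

  green-inverseʳ : ∀ f x → hamiltonian (green α₀>0 Ĝ f ⟨$⟩_) x ≈ᶜ f ⟨$⟩ x
  green-inverseʳ f x = begin
    hamiltonian (green α₀>0 Ĝ f ⟨$⟩_) x
      ≈⟨ hamiltonian-cong (green-expansion f) x ⟩
    hamiltonian (λ x → ∑[ Ĝ ] λ χ → 1/∣G∣ *ᶜ (weight χ *ᶜ transform (f ⟨$⟩_) χ) *ᶜ value χ x) x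
      ≈⟨ hamiltonian-∑ {Finite.size Ĝ} _ (λ i → value (Finite.element Ĝ i)) x ⟩
    ∑[ Ĝ ] (λ χ → 1/∣G∣ *ᶜ (weight χ *ᶜ transform (f ⟨$⟩_) χ) *ᶜ hamiltonian (value χ) x)
      ≈⟨ sum-cong-≋ {Finite.size Ĝ} (λ i → ℂR.trans
           (ℂR.*-congˡ (hamiltonian-character (Finite.element Ĝ i) x))
           (cancel (Finite.element Ĝ i))) ⟩
    ∑[ Ĝ ] (λ χ → 1/∣G∣ *ᶜ transform (f ⟨$⟩_) χ *ᶜ value χ x)
      ≈⟨ inversion (f ⟨$⟩_) (Func.cong f) x ⟩
    f ⟨$⟩ x ∎
    where
    cancel : ∀ χ → 1/∣G∣ *ᶜ (weight χ *ᶜ transform (f ⟨$⟩_) χ) *ᶜ (symbol χ *ᶜ value χ x)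
                     ≈ᶜ 1/∣G∣ *ᶜ transform (f ⟨$⟩_) χ *ᶜ value χ x
    cancel χ = begin
      1/∣G∣ *ᶜ (w *ᶜ t) *ᶜ (symbol χ *ᶜ z)    ≈⟨ ℂR.*-assoc (1/∣G∣ *ᶜ (w *ᶜ t)) (symbol χ) z ⟨
      1/∣G∣ *ᶜ (w *ᶜ t) *ᶜ symbol χ *ᶜ z      ≈⟨ ℂR.*-congʳ (ℂR.*-assoc 1/∣G∣ (w *ᶜ t) (symbol χ)) ⟩
      1/∣G∣ *ᶜ (w *ᶜ t *ᶜ symbol χ) *ᶜ z      ≈⟨ ℂR.*-congʳ (ℂR.*-congˡ (begin
        w *ᶜ t *ᶜ symbol χ                     ≈⟨ xy∙z≈xz∙y w t (symbol χ) ⟩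
        w *ᶜ symbol χ *ᶜ t                     ≈⟨ ℂR.*-congʳ (inv-inverseˡ (symbol χ) (eigenvalue+α₀≉0 χ α₀>0)) ⟩
        1ᶜ *ᶜ t                                ≈⟨ ℂR.*-identityˡ t ⟩
        t                                      ∎)) ⟩
      1/∣G∣ *ᶜ t *ᶜ z                         ∎
      where
      w = weight χ
      t = transform (f ⟨$⟩_) χ
      z = value χ x

  green-inverseˡ : ∀ f x → green α₀>0 Ĝ (H₀ α₀ f) ⟨$⟩ x ≈ᶜ f ⟨$⟩ x
  green-inverseˡ f x = begin
    green α₀>0 Ĝ (H₀ α₀ f) ⟨$⟩ x
      ≈⟨ green-expansion (H₀ α₀ f) x ⟩
    ∑[ Ĝ ] (λ χ → 1/∣G∣ *ᶜ (weight χ *ᶜ transform (hamiltonian (f ⟨$⟩_)) χ) *ᶜ value χ x)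
      ≈⟨ sum-cong-≋ {Finite.size Ĝ} (λ i → ℂR.*-congʳ (ℂR.*-congˡ (cancel (Finite.element Ĝ i)))) ⟩
    ∑[ Ĝ ] (λ χ → 1/∣G∣ *ᶜ transform (f ⟨$⟩_) χ *ᶜ value χ x)
      ≈⟨ inversion (f ⟨$⟩_) (Func.cong f) x ⟩
    f ⟨$⟩ x ∎
    where
    cancel : ∀ χ → weight χ *ᶜ transform (hamiltonian (f ⟨$⟩_)) χ ≈ᶜ transform (f ⟨$⟩_) χ
    cancel χ = begin
      weight χ *ᶜ transform (hamiltonian (f ⟨$⟩_)) χ     ≈⟨ ℂR.*-congˡ (transform-hamiltonian (f ⟨$⟩_) (Func.cong f) χ) ⟩
      weight χ *ᶜ (symbol χ *ᶜ transform (f ⟨$⟩_) χ)     ≈⟨ ℂR.*-assoc (weight χ) (symbol χ) _ ⟨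
      weight χ *ᶜ symbol χ *ᶜ transform (f ⟨$⟩_) χ       ≈⟨ ℂR.*-congʳ (inv-inverseˡ (symbol χ) (eigenvalue+α₀≉0 χ α₀>0)) ⟩
      1ᶜ *ᶜ transform (f ⟨$⟩_) χ                         ≈⟨ ℂR.*-identityˡ _ ⟩
      transform (f ⟨$⟩_) χ                               ∎

corollary7 : ∀ {c ℓ p} (G : FiniteAbelianGroup c ℓ) (S : SymmetricSubset G p) (α₀ : ℝ) (α₀>0 : 0ℝ < α₀) →
    let open Diffusion G S
        open Setoid (ℓ² G) using (_≈_)
    in Finite (dual G) ×
       ((Ĝ : Finite (dual G)) → Inverseᵇ _≈_ _≈_ (H₀ α₀) (green α₀>0 Ĝ))
corollary7 G S α₀ α₀>0 = Duality.dual-finite G , λ Ĝ →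
  let open GreenFunction G S α₀>0 Ĝ
      open Diffusion G S
  in (λ {f} {h} h≈ x → ℂR.trans (hamiltonian-cong h≈ x) (green-inverseʳ f x))
   , (λ {f} {h} h≈ x → ℂR.trans (green-cong h (H₀ α₀ f) h≈ x) (green-inverseˡ f x))
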